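{- Consider the relations $\sim_\alpha$ on closed terms over $\mathcal{K}_1$ (coded effectively by natural numbers). For every $k>0$, the relation $\sim_{\omega k}$ is $\Sigma^0_{2k+1}$-complete. For every $k\in\omega$ and every $n>0$, the relation $\sim_{\omega k+n}$ is $\Pi^0_{2k+2}$-complete.
   Context: Closed terms over a partial applicative structure $\mathcal{A}$ (a set with partial application $ab$, associating to the left) are built from elements by application; $s\simeq t$ means both undefined or both defined and equal. Relations $\sim_\alpha$ on closed terms: $s\sim_0 t$ iff $s\simeq t$; $s \sim_{\alpha+1} t$ iff $sx \sim_\alpha tx$ for all $x\in\mathcal{A}$; for limit $\alpha$, $s\sim_\alpha t$ iff $s\sim_\beta t$ for some $\beta<\alpha$. $\mathcal{K}_1$ is the pca on $\omega$ with $n\cdot m=\Phi_n(m)$ ($\Phi_n$ the $n$-th partial computable function). $\Gamma$-complete means definable in the arithmetical class $\Gamma$ and every $\Gamma$ set many-one reduces to it. -}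

module Defs where

open import Data.Nat using (ℕ; zero; suc; _+_; _*_; _≤_)
open import Data.Product using (Σ; _×_; _,_; proj₁; proj₂; ∃)
open import Data.Sum using (_⊎_; inj₁; inj₂)
open import Data.List using (List; []; _∷_)
open import Data.Maybe using (Maybe; just; nothing)
open import Data.Empty using (⊥)
open import Relation.Nullary using (¬_)
open import Relation.Binary.PropositionalEquality using (_≡_)
open import Function.Bundles using (_⇔_)
open import Level using (Lift; 0ℓ) renaming (suc to lsuc)

-- Cantor pairing: structural enumeration of ℕ × ℕ (a bijection ℕ ≅ ℕ × ℕ)

next : ℕ × ℕ → ℕ × ℕ
next (x , zero)  = (zero , suc x)
next (x , suc y) = (suc x , y)

unpair : ℕ → ℕ × ℕ
unpair zero    = (zero , zero)
unpair (suc n) = next (unpair n)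

parity : ℕ → ℕ ⊎ ℕ
parity zero = inj₁ zero
parity (suc n) with parity n
... | inj₁ m = inj₂ m
... | inj₂ m = inj₁ (suc m)

-- A Turing-complete model: register machines, Gödel-numbered by ℕ.
-- Halting = jumping outside the program; output is register 0.

data Instr : Set where
  inc : (r j : ℕ) → Instr        -- R[r] += 1 ; goto j
  dec : (r j k : ℕ) → Instr      -- if R[r] = 0 goto k else R[r] -= 1 ; goto j

Program : Set
Program = List Instr

nth : Program → ℕ → Maybe Instr
nth []       _       = nothing
nth (i ∷ _)  zero    = just i
nth (_ ∷ is) (suc n) = nth is n

update : (ℕ → ℕ) → ℕ → ℕ → (ℕ → ℕ)
update R zero    v zero    = v
update R zero    v (suc m) = R (suc m)
update R (suc r) v zero    = R zero
update R (suc r) v (suc m) = update (λ i → R (suc i)) r v m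

run : ℕ → Program → ℕ → (ℕ → ℕ) → Maybe ℕ
run zero     p pc R = nothing
run (suc f)  p pc R with nth p pc
... | nothing        = just (R zero)
... | just (inc r j) = run f p j (update R r (suc (R r)))
... | just (dec r j k) with R r
...   | zero  = run f p k R
...   | suc m = run f p j (update R r m)

decInstr : ℕ → Instr
decInstr a with unpair a
... | (zero  , b) = inc (proj₁ (unpair b)) (proj₂ (unpair b))
... | (suc _ , b) = dec (proj₁ (unpair b))
                        (proj₁ (unpair (proj₂ (unpair b))))
                        (proj₂ (unpair (proj₂ (unpair b))))

decList : ℕ → ℕ → Program
decList zero    _       = []
decList (suc f) zero    = []
decList (suc f) (suc n) = decInstr (proj₁ (unpair n)) ∷ decList f (proj₂ (unpair n))

prog : ℕ → Program
prog e = decList (suc e) e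

input : ℕ → (ℕ → ℕ)
input x zero    = x
input x (suc _) = zero

_·_⇓_ : ℕ → ℕ → ℕ → Set
e · x ⇓ v = Σ ℕ λ f → run f (prog e) zero (input x) ≡ just v

data Term : Set where
  el  : ℕ → Term
  app : Term → Term → Term

data _⇓_ : Term → ℕ → Set where
  el⇓  : ∀ {n} → el n ⇓ n
  app⇓ : ∀ {s t a b v} → s ⇓ a → t ⇓ b → a · b ⇓ v → app s t ⇓ v

Defined : Term → Set
Defined s = Σ ℕ λ v → s ⇓ v

_≃_ : Term → Term → Set
s ≃ t = (¬ Defined s × ¬ Defined t) ⊎ (Σ ℕ λ v → s ⇓ v × t ⇓ v)

-- sim k n s t  is  s ∼_{ω·k+n} t ;  below k s t  is  ∃ β < ω·k. s ∼_β t
mutual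
  sim : ℕ → ℕ → Term → Term → Set
  sim zero    zero    s t = s ≃ t
  sim (suc k) zero    s t = below (suc k) s t
  sim k       (suc n) s t = (x : ℕ) → sim k n (app s (el x)) (app t (el x))

  below : ℕ → Term → Term → Set
  below zero    s t = ⊥
  below (suc k) s t = below k s t ⊎ (Σ ℕ λ m → sim k m s t)

decT : ℕ → ℕ → Term
decT zero    _ = el zero
decT (suc f) n with parity n
... | inj₁ m = el m
... | inj₂ m = app (decT f (proj₁ (unpair m))) (decT f (proj₂ (unpair m)))

decodeTerm : ℕ → Term
decodeTerm n = decT (suc n) n

SimSet : ℕ → ℕ → ℕ → Set
SimSet k n c = sim k n (decodeTerm (proj₁ (unpair c))) (decodeTerm (proj₂ (unpair c)))

pair⇓ : ℕ → ℕ → ℕ → Set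
pair⇓ c x y = unpair c ≡ (x , y)

Computable : (ℕ → Set) → Set
Computable P = Σ ℕ λ e → (x : ℕ) →
  (P x × e · x ⇓ 1) ⊎ (¬ P x × e · x ⇓ 0)

mutual
  Σ⁰ : ℕ → (ℕ → Set) → Set₁
  Σ⁰ zero    P = Lift (lsuc 0ℓ) (Computable P)
  Σ⁰ (suc n) P = Σ (ℕ → Set) λ Q → Π⁰ n Q ×
    ((x : ℕ) → P x ⇔ (Σ ℕ λ y → Σ ℕ λ c → pair⇓ c x y × Q c))

  Π⁰ : ℕ → (ℕ → Set) → Set₁
  Π⁰ zero    P = Lift (lsuc 0ℓ) (Computable P)
  Π⁰ (suc n) P = Σ (ℕ → Set) λ Q → Σ⁰ n Q ×
    ((x : ℕ) → P x ⇔ ((y : ℕ) → (c : ℕ) → pair⇓ c x y → Q c))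

_≤m_ : (ℕ → Set) → (ℕ → Set) → Set
A ≤m B = Σ ℕ λ e → Σ (ℕ → ℕ) λ f →
  ((x : ℕ) → e · x ⇓ f x) × ((x : ℕ) → A x ⇔ B (f x))

Complete : ((ℕ → Set) → Set₁) → (ℕ → Set) → Set₁
Complete Γ B = Γ B × ((A : ℕ → Set) → Γ A → A ≤m B)

-- Upper bounds.  Terms are evaluated for a bounded number of steps by a primitive recursive
-- interpreter, so ≃ is Π⁰₂, and s ∼_{ω(k+1)} t says that for some m and all x₁ … x_m one has
-- s x₁ … x_m ∼_{ωk} t x₁ … x_m, which adds two quantifiers.
--
-- Lower bounds.  For a Σ⁰_{2k+1} set Q one computes from x and m two elements that are related by
-- ∼_{ωk+1} if Q x, and otherwise by ∼_{ωk+m+2} but not by ∼_{ωk+m+1}.  For k = 0, let c_m be an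
-- element that can be applied exactly m times; t is the constant function c_m, and s waits for
-- Q x before returning c_m.  For A in Σ⁰_{2k+3} there is Q in Σ⁰_{2k+1} such that, if A x, then
-- Q (x , m , y) for all large m and all y, and otherwise for every m it fails for some y.
-- The functions taking (m , y) to the elements for Q (x , m , y) and m are then related by
-- ∼_{ω(k+1)} iff A x, and by ∼_{ω(k+1)+1} always; padding them with m + 1 dummy
-- arguments gives the elements for k + 1.

module Submission where

open import Defs
open import Level using (0ℓ; lift)
open import Axiom.ExcludedMiddle using (ExcludedMiddle)
open import Axiom.DoubleNegationElimination using (em⇒dne)
open import Data.Nat hiding (parity)
open import Data.Nat.Properties
open import Data.Nat.Induction using (<-rec)
open import Data.Product using (Σ; _×_; _,_; proj₁; proj₂; ∃)
open import Data.Sum using (_⊎_; inj₁; inj₂)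
open import Data.List using ([]; _∷_; _++_; length)
open import Data.List.Properties using (++-assoc; length-++)
open import Data.Maybe using (Maybe; just; nothing)
open import Data.Maybe.Properties using (just-injective)
open import Data.Empty using (⊥-elim)
open import Function using (_∘_)
open import Function.Bundles using (_⇔_; mk⇔; module Equivalence)
open import Function.Construct.Composition using (_⇔-∘_)
open import Function.Related.Propositional using (≡⇒)
open import Relation.Binary.PropositionalEquality
open import Relation.Nullary using (¬_; yes; no)

open Equivalence using (to; from)

-- A limit relation asks for one level that serves all arguments. A function enumerating pairs that
-- are each related at some level `ω k + n`, but at no common `n`, is thus related at
-- `ω (k + 1) + 1` and not at `ω (k + 1)`. This is why failing pairs must still be related, at a
-- controlled level: failure up to `m + 1` makes the levels unbounded along the family, and success
-- at `m + 2` keeps each member below the limit.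
--
-- The family comes from reading a number `y` as a sequence of challenges. If `A x` is
-- `∃ w ∀ y B (x , w , y)`, then `Q (x , m , y)` says that some `w ≤ m` meets its own challenge,
-- entry `w` of `y`. A true witness meets every challenge once `m` admits it; without a witness, the
-- counterexamples for the finitely many `w ≤ m` fit into one `y`.
--
-- The indices are all built with `smn`: for a primitive recursive test, an index of the search for
-- a success is primitive recursive in a parameter. Constant functions, universal functions and
-- delays differ only in what the search variable stands for.

-- The inverse of the Cantor unpairing

tri : ℕ → ℕ
tri zero    = zero
tri (suc n) = suc n + tri n

abstract
  -- `next` enters the diagonal `x + y = s` at `(0 , s)` after `tri s` steps and then increases the
  -- first component; this is the resulting index of `(x , y)`.
  pair : ℕ → ℕ → ℕ
  pair x y = x + tri (x + y)

fst snd : ℕ → ℕ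
fst n = proj₁ (unpair n)
snd n = proj₂ (unpair n)

unpair-tri : ∀ s x y → x + y ≡ s → unpair (x + tri s) ≡ (x , y)
unpair-tri zero    zero    .zero refl = refl
unpair-tri (suc s) zero    .(suc s) refl =
  cong next (unpair-tri s s zero (+-identityʳ s))
unpair-tri (suc s) (suc x) y       eq =
  cong next (unpair-tri (suc s) x (suc y) (trans (+-suc x y) eq))

abstract
  pair-def : ∀ x y → pair x y ≡ x + tri (x + y)
  pair-def x y = refl

unpair-pair : ∀ x y → unpair (pair x y) ≡ (x , y)
unpair-pair x y = trans (cong unpair (pair-def x y)) (unpair-tri (x + y) x y refl)

fst-pair : ∀ x y → fst (pair x y) ≡ x
fst-pair x y = cong proj₁ (unpair-pair x y)

snd-pair : ∀ x y → snd (pair x y) ≡ y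
snd-pair x y = cong proj₂ (unpair-pair x y)

pair-next : ∀ x y → pair (proj₁ (next (x , y))) (proj₂ (next (x , y))) ≡ suc (pair x y)
pair-next x zero    rewrite pair-def 0 (suc x) | pair-def x 0 | +-identityʳ x = refl
pair-next x (suc y) rewrite pair-def (suc x) y | pair-def x (suc y) | +-suc x y = refl

pair-unpair : ∀ n → pair (fst n) (snd n) ≡ n
pair-unpair zero    = pair-def 0 0
pair-unpair (suc n) = trans (pair-next (fst n) (snd n)) (cong suc (pair-unpair n))

n≤tri : ∀ n → n ≤ tri n
n≤tri zero    = z≤n
n≤tri (suc n) = m≤m+n (suc n) (tri n)

fst≤pair : ∀ x y → x ≤ pair x y
fst≤pair x y = subst (x ≤_) (sym (pair-def x y)) (m≤m+n x _)

snd≤pair : ∀ x y → y ≤ pair x y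
snd≤pair x y = subst (y ≤_) (sym (pair-def x y)) (≤-trans (m≤n+m y x) (≤-trans (n≤tri (x + y)) (m≤n+m _ x)))

fst≤ : ∀ n → fst n ≤ n
fst≤ n = subst (fst n ≤_) (pair-unpair n) (fst≤pair (fst n) (snd n))

snd≤ : ∀ n → snd n ≤ n
snd≤ n = subst (snd n ≤_) (pair-unpair n) (snd≤pair (fst n) (snd n))

-- Primitive recursive functions

iterate : (ℕ → ℕ) → ℕ → ℕ → ℕ
iterate f zero    a = a
iterate f (suc n) a = iterate f n (f a)

iterate-suc : ∀ f n a → iterate f (suc n) a ≡ f (iterate f n a)
iterate-suc f zero    a = refl
iterate-suc f (suc n) a = iterate-suc f n (f a)

iterate-fix : ∀ f n {a} → f a ≡ a → iterate f n a ≡ a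
iterate-fix f zero    eq = refl
iterate-fix f (suc n) eq = trans (cong (iterate f n) eq) (iterate-fix f n eq)

-- Functions of several arguments take a tuple, coded by the pairing that Defs.unpair inverts.
data PR : (ℕ → ℕ) → Set where
  zeroᵖ : PR (λ _ → zero)
  sucᵖ  : PR suc
  fstᵖ  : PR fst
  sndᵖ  : PR snd
  pairᵖ : ∀ {f g} → PR f → PR g → PR (λ x → pair (f x) (g x))
  compᵖ : ∀ {g f} → PR g → PR f → PR (λ x → g (f x))
  iterᵖ : ∀ {f} → PR f → PR (λ x → iterate f (fst x) (snd x))
  -- `PR` is indexed by Agda functions, so closure under pointwise equality has to be built in.
  extᵖ  : ∀ {f g} → PR f → (∀ x → f x ≡ g x) → PR g

PR₂ : (ℕ → ℕ → ℕ) → Set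
PR₂ g = PR (λ x → g (fst x) (snd x))

ifz : ℕ → ℕ → ℕ → ℕ
ifz zero    a b = a
ifz (suc _) a b = b

infixl 6 _+ᵖ_ _∸ᵖ_

abstract
  idᵖ : PR (λ x → x)
  idᵖ = extᵖ (pairᵖ fstᵖ sndᵖ) pair-unpair

  constᵖ : ∀ n → PR (λ _ → n)
  constᵖ zero    = zeroᵖ
  constᵖ (suc n) = compᵖ sucᵖ (constᵖ n)

  comp₂ᵖ : ∀ {g a b} → PR₂ g → PR a → PR b → PR (λ x → g (a x) (b x))
  comp₂ᵖ {g} {a} {b} pg pa pb =
    extᵖ (compᵖ pg (pairᵖ pa pb)) λ x → cong₂ g (fst-pair (a x) (b x)) (snd-pair (a x) (b x))

  -- `iterᵖ` iterates a function of one argument; the parameter travels unchanged in the first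
  -- component of the state.
  iter₂ᵖ : ∀ {g e n a} → PR₂ g → PR e → PR n → PR a → PR (λ x → iterate (g (e x)) (n x) (a x))
  iter₂ᵖ {g} {e} {n} {a} pg pe pn pa =
    extᵖ (compᵖ sndᵖ (comp₂ᵖ {iterate step} (iterᵖ (pairᵖ fstᵖ pg)) pn (pairᵖ pe pa)))
         λ x → trans (cong snd (carry (e x) (n x) (a x))) (snd-pair (e x) _)
    where
    step : ℕ → ℕ
    step s = pair (fst s) (g (fst s) (snd s))
    carry : ∀ e n a → iterate step n (pair e a) ≡ pair e (iterate (g e) n a)
    carry e zero    a = refl
    carry e (suc n) a = trans (cong (iterate step n)
      (cong₂ pair (fst-pair e a) (cong₂ g (fst-pair e a) (snd-pair e a)))) (carry e n (g e a))

  ifzᵖ : ∀ {c a b} → PR c → PR a → PR b → PR (λ x → ifz (c x) (a x) (b x))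
  ifzᵖ {c} {a} {b} pc pa pb = extᵖ (iter₂ᵖ {λ e _ → e} fstᵖ pb pc pa) λ x → lem (c x) (a x) (b x)
    where
    lem : ∀ n a b → iterate (λ _ → b) n a ≡ ifz n a b
    lem zero    a b = refl
    lem (suc n) a b = iterate-fix (λ _ → b) n refl

  -- Kleene's device: iterate `(a , b) ↦ (b , b + 1)` from `(0 , 0)`, whose code is 0, and keep the
  -- lagging component.
  predᵖ : ∀ {f} → PR f → PR (λ x → pred (f x))
  predᵖ pf = compᵖ {pred} (extᵖ (compᵖ fstᵖ (comp₂ᵖ {iterate step} (iterᵖ (pairᵖ sndᵖ (compᵖ sucᵖ sndᵖ)))
                                  idᵖ (constᵖ 0))) lem) pf
    where
    step : ℕ → ℕ
    step s = pair (snd s) (suc (snd s))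
    go : ∀ n → iterate step n 0 ≡ pair (pred n) n
    go zero    = sym (pair-def 0 0)
    go (suc n) = trans (iterate-suc step n 0) (trans (cong step (go n)) (cong (λ k → pair k (suc k)) (snd-pair (pred n) n)))
    lem : ∀ n → fst (iterate step n 0) ≡ pred n
    lem n = trans (cong fst (go n)) (fst-pair (pred n) n)

  _+ᵖ_ : ∀ {f g} → PR f → PR g → PR (λ x → f x + g x)
  _+ᵖ_ {f} {g} pf pg = extᵖ (comp₂ᵖ {iterate suc} (iterᵖ sucᵖ) pf pg) λ x → lem (f x) (g x)
    where
    lem : ∀ n a → iterate suc n a ≡ n + a
    lem zero    a = refl
    lem (suc n) a = trans (lem n (suc a)) (+-suc n a)

  _∸ᵖ_ : ∀ {f g} → PR f → PR g → PR (λ x → f x ∸ g x)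
  _∸ᵖ_ {f} {g} pf pg = extᵖ (comp₂ᵖ {iterate pred} (iterᵖ (predᵖ idᵖ)) pg pf) λ x → lem (g x) (f x)
    where
    lem : ∀ n a → iterate pred n a ≡ a ∸ n
    lem zero    a       = refl
    lem (suc n) zero    = iterate-fix pred n refl
    lem (suc n) (suc a) = lem n a

differ : ℕ → ℕ → ℕ
differ a b = (a ∸ b) + (b ∸ a)

differᵖ : ∀ {f g} → PR f → PR g → PR (λ x → differ (f x) (g x))
differᵖ pf pg = (pf ∸ᵖ pg) +ᵖ (pg ∸ᵖ pf)

differ-refl : ∀ a → differ a a ≡ 0
differ-refl a rewrite n∸n≡0 a = refl

differ-0 : ∀ a b → differ a b ≡ 0 → a ≡ b
differ-0 a b eq = ≤-antisym (m∸n≡0⇒m≤n (m+n≡0⇒m≡0 (a ∸ b) eq))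
                            (m∸n≡0⇒m≤n (m+n≡0⇒n≡0 (a ∸ b) eq))

-- A structured language over registers

State : Set
State = ℕ → ℕ

infixr 5 _◂_
_◂_ : ℕ → State → State
(a ◂ R) zero    = a
(a ◂ R) (suc i) = R i

-- Pointwise equal to Defs.update, but computing on states of the form a ◂ b ◂ … .
write : ℕ → ℕ → State → State
write zero    v R = v ◂ (λ i → R (suc i))
write (suc r) v R = R zero ◂ write r v (λ i → R (suc i))

write≗update : ∀ r v R → write r v R ≗ update R r v
write≗update zero    v R zero    = refl
write≗update zero    v R (suc i) = refl
write≗update (suc r) v R zero    = refl
write≗update (suc r) v R (suc i) = write≗update r v (λ i → R (suc i)) i

infixr 6 _⨾_
data Cmd : Set where
  incr clear : ℕ → Cmd
  _⨾_        : Cmd → Cmd → Cmd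
  loop       : ℕ → Cmd → Cmd
  ifdec      : ℕ → Cmd → Cmd → Cmd

infix 4 _⊢_⇝_
-- A derivation certifies termination and says nothing about divergence. The unbounded search, which
-- may diverge, is therefore analysed on machine runs, with derivations only for its single rounds.
data _⊢_⇝_ : Cmd → State → State → Set where
  incr⇝  : ∀ {r R} → incr r ⊢ R ⇝ write r (suc (R r)) R
  clear⇝ : ∀ {r R} → clear r ⊢ R ⇝ write r 0 R
  seq⇝   : ∀ {c d R S T} → c ⊢ R ⇝ S → d ⊢ S ⇝ T → c ⨾ d ⊢ R ⇝ T
  done⇝  : ∀ {r c R} → R r ≡ 0 → loop r c ⊢ R ⇝ R
  step⇝  : ∀ {r c R S T m} → R r ≡ suc m → c ⊢ write r m R ⇝ S → loop r c ⊢ S ⇝ T → loop r c ⊢ R ⇝ T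
  zero⇝  : ∀ {r c d R S} → R r ≡ 0 → c ⊢ R ⇝ S → ifdec r c d ⊢ R ⇝ S
  suc⇝   : ∀ {r c d R S m} → R r ≡ suc m → d ⊢ write r m R ⇝ S → ifdec r c d ⊢ R ⇝ S

-- Commands leave garbage above their result; running them on higher registers protects what is
-- stored below.
shift : Cmd → Cmd
shift (incr r)      = incr (suc r)
shift (clear r)     = clear (suc r)
shift (c ⨾ d)       = shift c ⨾ shift d
shift (loop r c)    = loop (suc r) (shift c)
shift (ifdec r c d) = ifdec (suc r) (shift c) (shift d)

shift⇝ : ∀ {c R S} a → c ⊢ R ⇝ S → shift c ⊢ a ◂ R ⇝ a ◂ S
shift⇝ a incr⇝           = incr⇝
shift⇝ a clear⇝          = clear⇝
shift⇝ a (seq⇝ p q)      = seq⇝ (shift⇝ a p) (shift⇝ a q)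
shift⇝ a (done⇝ e)       = done⇝ e
shift⇝ a (step⇝ e p q)   = step⇝ e (shift⇝ a p) (shift⇝ a q)
shift⇝ a (zero⇝ e p)     = zero⇝ e (shift⇝ a p)
shift⇝ a (suc⇝ e p)      = suc⇝ e (shift⇝ a p)

-- Primitive recursive functions as commands

move10 : Cmd
move10 = loop 1 (incr 0)

move10⇝ : ∀ a b {R} → move10 ⊢ a ◂ b ◂ R ⇝ (b + a) ◂ 0 ◂ R
move10⇝ a zero    = done⇝ refl
move10⇝ a (suc b) {R} = step⇝ refl incr⇝
  (subst (λ k → move10 ⊢ suc a ◂ b ◂ R ⇝ k ◂ 0 ◂ R) (+-suc b a) (move10⇝ (suc a) b))

take1 : Cmd
take1 = clear 0 ⨾ move10

take1⇝ : ∀ a b {R} → take1 ⊢ a ◂ b ◂ R ⇝ b ◂ 0 ◂ R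
take1⇝ a b {R} = seq⇝ clear⇝ (subst (λ k → move10 ⊢ 0 ◂ b ◂ R ⇝ k ◂ 0 ◂ R) (+-identityʳ b) (move10⇝ 0 b))

move20 : Cmd
move20 = loop 2 (incr 0)

move20⇝ : ∀ a b c {R} → move20 ⊢ a ◂ b ◂ c ◂ R ⇝ (c + a) ◂ b ◂ 0 ◂ R
move20⇝ a b zero    = done⇝ refl
move20⇝ a b (suc c) {R} = step⇝ refl incr⇝
  (subst (λ k → move20 ⊢ suc a ◂ b ◂ c ◂ R ⇝ k ◂ b ◂ 0 ◂ R) (+-suc c a) (move20⇝ (suc a) b c))

take2 : Cmd
take2 = clear 0 ⨾ move20

take2⇝ : ∀ a b c {R} → take2 ⊢ a ◂ b ◂ c ◂ R ⇝ c ◂ b ◂ 0 ◂ R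
take2⇝ a b c {R} = seq⇝ clear⇝ (subst (λ k → move20 ⊢ 0 ◂ b ◂ c ◂ R ⇝ k ◂ b ◂ 0 ◂ R) (+-identityʳ c) (move20⇝ 0 b c))

fork : Cmd
fork = loop 0 (incr 1 ⨾ incr 2)

fork⇝ : ∀ a b c {R} → fork ⊢ a ◂ b ◂ c ◂ R ⇝ 0 ◂ (a + b) ◂ (a + c) ◂ R
fork⇝ zero    b c = done⇝ refl
fork⇝ (suc a) b c {R} = step⇝ refl (seq⇝ incr⇝ incr⇝)
  (subst₂ (λ k l → fork ⊢ a ◂ suc b ◂ suc c ◂ R ⇝ 0 ◂ k ◂ l ◂ R) (+-suc a b) (+-suc a c) (fork⇝ a (suc b) (suc c)))

dup : Cmd
dup = clear 1 ⨾ clear 2 ⨾ fork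

dup⇝ : ∀ a {R} → ∃ λ S → dup ⊢ a ◂ R ⇝ 0 ◂ a ◂ a ◂ S
dup⇝ a {R} = _ , seq⇝ clear⇝ (seq⇝ clear⇝
  (subst (λ k → fork ⊢ a ◂ 0 ◂ 0 ◂ (λ i → R (suc (suc i))) ⇝ 0 ◂ k ◂ k ◂ (λ i → R (suc (suc i))))
         (+-identityʳ a) (fork⇝ a 0 0)))

nextC : Cmd
nextC = ifdec 1 (loop 0 (incr 1) ⨾ incr 1) (incr 0)

move01⇝ : ∀ a b {R} → loop 0 (incr 1) ⊢ a ◂ b ◂ R ⇝ 0 ◂ (a + b) ◂ R
move01⇝ zero    b = done⇝ refl
move01⇝ (suc a) b {R} = step⇝ refl incr⇝
  (subst (λ k → loop 0 (incr 1) ⊢ a ◂ suc b ◂ R ⇝ 0 ◂ k ◂ R) (+-suc a b) (move01⇝ a (suc b)))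

nextC⇝ : ∀ p {R} → nextC ⊢ proj₁ p ◂ proj₂ p ◂ R ⇝ proj₁ (next p) ◂ proj₂ (next p) ◂ R
nextC⇝ (x , zero)  {R} = zero⇝ refl (seq⇝
  (subst (λ k → loop 0 (incr 1) ⊢ x ◂ 0 ◂ R ⇝ 0 ◂ k ◂ R) (+-identityʳ x) (move01⇝ x 0)) incr⇝)
nextC⇝ (x , suc y) = suc⇝ refl incr⇝

nexts⇝ : ∀ m j {R} → loop 2 nextC ⊢ fst j ◂ snd j ◂ m ◂ R ⇝ fst (m + j) ◂ snd (m + j) ◂ 0 ◂ R
nexts⇝ zero    j     = done⇝ refl
nexts⇝ (suc m) j {R} = step⇝ refl (nextC⇝ (unpair j))
  (subst (λ k → loop 2 nextC ⊢ fst (suc j) ◂ snd (suc j) ◂ m ◂ R ⇝ fst k ◂ snd k ◂ 0 ◂ R) (+-suc m j) (nexts⇝ m (suc j)))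

unpairC : Cmd
unpairC = dup ⨾ clear 1 ⨾ loop 2 nextC

unpairC⇝ : ∀ n {R} → ∃ λ S → unpairC ⊢ n ◂ R ⇝ fst n ◂ snd n ◂ S
unpairC⇝ n {R} with dup⇝ n {R}
... | S , p = _ , seq⇝ p (seq⇝ clear⇝
  (subst (λ k → loop 2 nextC ⊢ 0 ◂ 0 ◂ n ◂ S ⇝ fst k ◂ snd k ◂ 0 ◂ S) (+-identityʳ n) (nexts⇝ n 0)))

addBack⇝ : ∀ m a t {R} → loop 1 (incr 2 ⨾ incr 0) ⊢ t ◂ m ◂ a ◂ R ⇝ (m + t) ◂ 0 ◂ (m + a) ◂ R
addBack⇝ zero    a t = done⇝ refl
addBack⇝ (suc m) a t {R} = step⇝ refl (seq⇝ incr⇝ incr⇝)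
  (subst₂ (λ k l → loop 1 (incr 2 ⨾ incr 0) ⊢ suc t ◂ m ◂ suc a ◂ R ⇝ k ◂ 0 ◂ l ◂ R)
          (+-suc m t) (+-suc m a) (addBack⇝ m (suc a) (suc t)))

triC : Cmd
triC = loop 1 (loop 1 (incr 2 ⨾ incr 0) ⨾ incr 2 ⨾ loop 0 (incr 1))

triC⇝ : ∀ s a {R} → triC ⊢ 0 ◂ s ◂ a ◂ R ⇝ 0 ◂ 0 ◂ (a + tri s) ◂ R
triC⇝ zero    a {R} = subst (λ k → triC ⊢ 0 ◂ 0 ◂ a ◂ R ⇝ 0 ◂ 0 ◂ k ◂ R) (sym (+-identityʳ a)) (done⇝ refl)
triC⇝ (suc s) a {R} = step⇝ refl
  (seq⇝ (subst (λ k → loop 1 (incr 2 ⨾ incr 0) ⊢ 0 ◂ s ◂ a ◂ R ⇝ k ◂ 0 ◂ (s + a) ◂ R) (+-identityʳ s) (addBack⇝ s a 0))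
  (seq⇝ incr⇝
        (subst (λ k → loop 0 (incr 1) ⊢ s ◂ 0 ◂ suc (s + a) ◂ R ⇝ 0 ◂ k ◂ suc (s + a) ◂ R) (+-identityʳ s) (move01⇝ s 0))))
  (subst (λ k → triC ⊢ 0 ◂ s ◂ suc (s + a) ◂ R ⇝ 0 ◂ 0 ◂ k ◂ R) eq (triC⇝ s (suc (s + a))))
  where
  eq : suc (s + a) + tri s ≡ a + tri (suc s)
  eq = trans (cong (_+ tri s) (+-comm (suc s) a)) (+-assoc a (suc s) (tri s))

pairC : Cmd
pairC = clear 2 ⨾ fork ⨾ triC ⨾ take2

pairC⇝ : ∀ x y {R} → ∃ λ S → pairC ⊢ x ◂ y ◂ R ⇝ pair x y ◂ S
pairC⇝ x y {R} = _ , seq⇝ clear⇝ (seq⇝ (fork⇝ x y 0) (seq⇝ (triC⇝ (x + y) (x + 0))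
  (subst (λ k → take2 ⊢ 0 ◂ 0 ◂ ((x + 0) + tri (x + y)) ◂ (λ i → R (suc i)) ⇝ k ◂ 0 ◂ 0 ◂ (λ i → R (suc i)))
         (trans (cong (_+ tri (x + y)) (+-identityʳ x)) (sym (pair-def x y))) (take2⇝ 0 0 _))))

cmd : ∀ {f} → PR f → Cmd
cmd zeroᵖ        = clear 0
cmd sucᵖ         = incr 0
cmd fstᵖ         = unpairC
cmd sndᵖ         = unpairC ⨾ take1
-- The argument is copied to registers 1 and 2. `p` uses up the upper copy, its result moves to
-- register 0, and `q` uses up the lower copy.
cmd (pairᵖ p q)  = dup ⨾ shift (shift (cmd p)) ⨾ take2 ⨾ shift (cmd q) ⨾ pairC
cmd (compᵖ p q)  = cmd q ⨾ cmd p
cmd (iterᵖ p)    = unpairC ⨾ loop 0 (shift (cmd p)) ⨾ take1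
cmd (extᵖ p _)   = cmd p

-- The registers above the argument hold arbitrary values before and after, so commands compose
-- without cleaning up: each clears its scratch registers itself.
Realises : (ℕ → ℕ) → Cmd → Set
Realises f c = ∀ a R → ∃ λ S → c ⊢ a ◂ R ⇝ f a ◂ S

iter-realises : ∀ {f c} → Realises f c → ∀ n a R → ∃ λ S →
                loop 0 (shift c) ⊢ n ◂ a ◂ R ⇝ 0 ◂ iterate f n a ◂ S
iter-realises r zero    a R = R , done⇝ refl
iter-realises {f} r (suc n) a R with r a R
... | S , p with iter-realises r n (f a) S
... | T , q = T , step⇝ refl (shift⇝ n p) q

cmd-realises : ∀ {f} (p : PR f) → Realises f (cmd p)
cmd-realises zeroᵖ a R = _ , clear⇝
cmd-realises sucᵖ  a R = _ , incr⇝
cmd-realises fstᵖ  a R with unpairC⇝ a {R}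
... | S , p = _ , p
cmd-realises sndᵖ  a R with unpairC⇝ a {R}
... | S , p = _ , seq⇝ p (take1⇝ _ _)
cmd-realises (pairᵖ {f} {g} p q) a R with dup⇝ a {R}
... | S₁ , d with cmd-realises p a S₁
... | S₂ , e with cmd-realises q a (0 ◂ S₂)
... | S₃ , h with pairC⇝ (f a) (g a) {S₃}
... | S₄ , k = S₄ , seq⇝ d (seq⇝ (shift⇝ 0 (shift⇝ a e)) (seq⇝ (take2⇝ _ _ _) (seq⇝ (shift⇝ (f a) h) k)))
cmd-realises (compᵖ {g} {f} p q) a R with cmd-realises q a R
... | S , d with cmd-realises p (f a) S
... | T , e = T , seq⇝ d e
cmd-realises (iterᵖ {f} p) a R with unpairC⇝ a {R}
... | S , d with iter-realises (cmd-realises p) (fst a) (snd a) S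
... | T , e = _ , seq⇝ d (seq⇝ e (take1⇝ _ _))
cmd-realises (extᵖ p eq) a R with cmd-realises p a R
... | S , d = S , subst (λ k → cmd p ⊢ a ◂ R ⇝ k ◂ S) (eq a) d

-- Runs of register machines

update-cong : ∀ r v {R S} → R ≗ S → update R r v ≗ update S r v
update-cong zero    v eq zero    = refl
update-cong zero    v eq (suc i) = eq (suc i)
update-cong (suc r) v eq zero    = eq zero
update-cong (suc r) v eq (suc i) = update-cong r v (eq ∘ suc) i

run-inc : ∀ f p pc R {r j} → nth p pc ≡ just (inc r j) →
          run (suc f) p pc R ≡ run f p j (update R r (suc (R r)))
run-inc f p pc R eq rewrite eq = refl

run-dec-0 : ∀ f p pc R {r j k} → nth p pc ≡ just (dec r j k) → R r ≡ 0 →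
            run (suc f) p pc R ≡ run f p k R
run-dec-0 f p pc R eq eq′ rewrite eq | eq′ = refl

run-dec-suc : ∀ f p pc R {r j k m} → nth p pc ≡ just (dec r j k) → R r ≡ suc m →
              run (suc f) p pc R ≡ run f p j (update R r m)
run-dec-suc f p pc R eq eq′ rewrite eq | eq′ = refl

run-halt : ∀ f p pc R → nth p pc ≡ nothing → run (suc f) p pc R ≡ just (R 0)
run-halt f p pc R eq rewrite eq = refl

run-cong : ∀ f p pc {R S} → R ≗ S → run f p pc R ≡ run f p pc S
run-cong zero    p pc eq = refl
run-cong (suc f) p pc {R} {S} eq with nth p pc
... | nothing = cong just (eq 0)
... | just (inc r j) rewrite eq r = run-cong f p j (update-cong r _ eq)
... | just (dec r j k) rewrite eq r with S r
...   | zero  = run-cong f p k eq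
...   | suc m = run-cong f p j (update-cong r m eq)

run-mono : ∀ f g p pc R {v} → f ≤ g → run f p pc R ≡ just v → run g p pc R ≡ just v
run-mono (suc f) (suc g) p pc R (s≤s f≤g) eq with nth p pc
... | nothing = eq
... | just (inc r j) = run-mono f g p j _ f≤g eq
... | just (dec r j k) with R r
...   | zero  = run-mono f g p k _ f≤g eq
...   | suc m = run-mono f g p j _ f≤g eq

-- The equation for every fuel lets a segment be put in front of a halting run and also be cut off
-- from one. Because of `suc steps` the fuel strictly drops along a segment, which the induction in
-- `search-sound` relies on.
record Reach (p : Program) (o : ℕ) (R : State) (k : ℕ) (S : State) : Set where
  constructor _via_
  field
    steps : ℕ
    runs  : ∀ f → run (suc steps + f) p o R ≡ run f p k S

reach-trans : ∀ {p o R k S l T} → Reach p o R k S → Reach p k S l T → Reach p o R l T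
reach-trans {p} {o} {R} (n via a) (m via b) = (n + suc m) via λ f →
  trans (cong (λ i → run (suc i) p o R) (+-assoc n (suc m) f)) (trans (a (suc m + f)) (b f))

reach-cong : ∀ {p o R R′ k S S′} → R′ ≗ R → S ≗ S′ → Reach p o R k S → Reach p o R′ k S′
reach-cong {p} {o} {k = k} e e′ (n via a) = n via λ f →
  trans (run-cong (suc n + f) p o e) (trans (a f) (run-cong f p k e′))

reach-inc : ∀ {p pc R r j} → nth p pc ≡ just (inc r j) → Reach p pc R j (write r (suc (R r)) R)
reach-inc {p} {pc} {R} {r} {j} eq = 0 via λ f →
  trans (run-inc f p pc R eq) (run-cong f p j (sym ∘ write≗update r _ R))

reach-dec-0 : ∀ {p pc R r j k} → nth p pc ≡ just (dec r j k) → R r ≡ 0 → Reach p pc R k R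
reach-dec-0 eq eq′ = 0 via λ f → run-dec-0 f _ _ _ eq eq′

reach-dec-suc : ∀ {p pc R r j k m} → nth p pc ≡ just (dec r j k) → R r ≡ suc m →
                Reach p pc R j (write r m R)
reach-dec-suc {p} {pc} {R} {r} {j} eq eq′ = 0 via λ f →
  trans (run-dec-suc f p pc R eq eq′) (run-cong f p j (sym ∘ write≗update r _ R))

Halts : Program → ℕ → State → ℕ → Set
Halts p o R v = ∃ λ f → run f p o R ≡ just v

reach-halts : ∀ {p o R k S v} → Reach p o R k S → Halts p k S v → Halts p o R v
reach-halts (n via a) (f , h) = suc n + f , trans (a f) h

reach-drop : ∀ {p o R k S v f} → Reach p o R k S → run f p o R ≡ just v →
             ∃ λ g → g < f × run g p k S ≡ just v
reach-drop {p} {o} {R} {k} {S} {v} {f} (n via a) h with ≤-total f (suc n + 0)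
-- Otherwise the run would halt within the segment, whose end with no fuel left is `nothing`.
... | inj₁ f≤n with trans (sym (run-mono f (suc n + 0) p o R f≤n h)) (a 0)
...   | ()
reach-drop {p} {o} {R} {k} {S} {v} {f} (n via a) h | inj₂ n≤f =
  f ∸ suc n , ∸-monoʳ-< {f} {suc n} {0} (s≤s z≤n) n≤f′ ,
  trans (sym (a (f ∸ suc n))) (trans (cong (λ i → run i p o R) (m+[n∸m]≡n n≤f′)) h)
  where
  n≤f′ : suc n ≤ f
  n≤f′ = subst (_≤ f) (+-identityʳ (suc n)) n≤f

-- Compiling commands

size : Cmd → ℕ
size (incr r)      = 1
size (clear r)     = 1
size (c ⨾ d)       = size c + size d
size (loop r c)    = suc (size c)
size (ifdec r c d) = suc (size c + size d)

-- compile c o k is the code of c placed at address o that exits to address k.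
compile : Cmd → ℕ → ℕ → Program
compile (incr r)      o k = inc r k ∷ []
compile (clear r)     o k = dec r o k ∷ []
compile (c ⨾ d)       o k = compile c o (o + size c) ++ compile d (o + size c) k
compile (loop r c)    o k = dec r (suc o) k ∷ compile c (suc o) o
compile (ifdec r c d) o k = dec r (suc o + size c) (suc o) ∷ compile c (suc o) k ++ compile d (suc o + size c) k

length-compile : ∀ c o k → length (compile c o k) ≡ size c
length-compile (incr r)   o k = refl
length-compile (clear r)  o k = refl
length-compile (c ⨾ d)    o k = trans (length-++ (compile c o _))
  (cong₂ _+_ (length-compile c o _) (length-compile d _ k))
length-compile (loop r c) o k = cong suc (length-compile c (suc o) o)
length-compile (ifdec r c d) o k = cong suc (trans (length-++ (compile c (suc o) k))
  (cong₂ _+_ (length-compile c (suc o) k) (length-compile d _ k)))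

-- The code of a command sits at `o`, whatever surrounds it; all arithmetic of list positions is
-- thus confined to `compile-at`.
At : Program → Cmd → ℕ → ℕ → Set
At p (incr r)      o k = nth p o ≡ just (inc r k)
At p (clear r)     o k = nth p o ≡ just (dec r o k)
At p (c ⨾ d)       o k = At p c o (o + size c) × At p d (o + size c) k
At p (loop r c)    o k = nth p o ≡ just (dec r (suc o) k) × At p c (suc o) o
At p (ifdec r c d) o k = nth p o ≡ just (dec r (suc o + size c) (suc o))
                         × At p c (suc o) k × At p d (suc o + size c) k

nth-++ : ∀ pre i post {o} → length pre ≡ o → nth (pre ++ i ∷ post) o ≡ just i
nth-++ []        i post refl = refl
nth-++ (_ ∷ pre) i post refl = nth-++ pre i post refl

compile-at : ∀ c pre post {o k} → length pre ≡ o → At (pre ++ compile c o k ++ post) c o k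
compile-at₂ : ∀ c d pre post {o l k} → length pre ≡ o →
  At (pre ++ (compile c o l ++ compile d (o + size c) k) ++ post) c o l
  × At (pre ++ (compile c o l ++ compile d (o + size c) k) ++ post) d (o + size c) k

compile-at (incr r)   pre post eq = nth-++ pre _ post eq
compile-at (clear r)  pre post eq = nth-++ pre _ post eq
compile-at (c ⨾ d)    pre post eq = compile-at₂ c d pre post eq
compile-at (loop r c) pre post {o} {k} eq =
  nth-++ pre _ _ eq ,
  subst (λ p → At p c (suc o) o) (++-assoc pre (_ ∷ []) _)
    (compile-at c (pre ++ dec r (suc o) k ∷ []) post (trans (length-++ pre) (trans (+-comm _ 1) (cong suc eq))))
compile-at (ifdec r c d) pre post {o} {k} eq =
  nth-++ pre _ _ eq ,
  subst (λ p → At p c (suc o) k × At p d (suc o + size c) k) (++-assoc pre (_ ∷ []) _)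
    (compile-at₂ c d (pre ++ dec r (suc o + size c) (suc o) ∷ []) post
      (trans (length-++ pre) (trans (+-comm _ 1) (cong suc eq))))

compile-at₂ c d pre post {o} {l} {k} eq =
  subst (λ p → At p c o l) (cong (pre ++_) (sym (++-assoc C D post))) (compile-at c pre (D ++ post) eq) ,
  subst (λ p → At p d (o + size c) k)
        (trans (++-assoc pre C (D ++ post)) (cong (pre ++_) (sym (++-assoc C D post))))
        (compile-at d (pre ++ C) post (trans (length-++ pre) (cong₂ _+_ eq (length-compile c o l))))
  where
  C D : Program
  C = compile c o l
  D = compile d (o + size c) k

write-same : ∀ r R {v} → R r ≡ v → R ≗ write r v R
write-same zero    R eq zero    = eq
write-same zero    R eq (suc i) = refl
write-same (suc r) R eq zero    = refl
write-same (suc r) R eq (suc i) = write-same r (R ∘ suc) eq i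

write-write : ∀ r u v R → write r v (write r u R) ≗ write r v R
write-write zero    u v R zero    = refl
write-write zero    u v R (suc i) = refl
write-write (suc r) u v R zero    = refl
write-write (suc r) u v R (suc i) = write-write r u v (R ∘ suc) i

write-read : ∀ r v R → write r v R r ≡ v
write-read zero    v R = refl
write-read (suc r) v R = write-read r v (R ∘ suc)

reach-clear : ∀ {p r o k} → nth p o ≡ just (dec r o k) → ∀ m R → R r ≡ m → Reach p o R k (write r 0 R)
reach-clear {r = r} at zero    R eq = reach-cong (λ _ → refl) (write-same r R eq) (reach-dec-0 at eq)
reach-clear {r = r} at (suc m) R eq = reach-trans (reach-dec-suc at eq)
  (reach-cong (λ _ → refl) (write-write r m 0 R) (reach-clear at m (write r m R) (write-read r m R)))

reach-cmd : ∀ {c R S} → c ⊢ R ⇝ S → ∀ {p o k} → At p c o k → Reach p o R k S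
reach-cmd incr⇝  at = reach-inc at
reach-cmd {clear r} {R} clear⇝ at = reach-clear at (R r) R refl
reach-cmd (seq⇝ p q) (at₁ , at₂) = reach-trans (reach-cmd p at₁) (reach-cmd q at₂)
reach-cmd (done⇝ eq) (at , _) = reach-dec-0 at eq
reach-cmd (step⇝ eq p q) at@(at₁ , at₂) =
  reach-trans (reach-dec-suc at₁ eq) (reach-trans (reach-cmd p at₂) (reach-cmd q at))
reach-cmd (zero⇝ eq p) (at₁ , at₂ , _) = reach-trans (reach-dec-0 at₁ eq) (reach-cmd p at₂)
reach-cmd (suc⇝ eq p) (at₁ , _ , at₃) = reach-trans (reach-dec-suc at₁ eq) (reach-cmd p at₃)

-- Loading a parameter

module Loader (C : Cmd) where

  E L : ℕ
  E = suc (size C)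
  L = suc E

  load : ℕ → ℕ → Program
  -- With equal targets, `dec` is an unconditional jump. Here register 2 is still 0; at the exit it
  -- may lose a unit, which does not affect the output.
  load o zero    = dec 2 1 1 ∷ []
  load o (suc n) = inc 1 (suc o) ∷ load (suc o) n

  -- Control enters at 0, jumps to the loader at L which puts the parameter x into register 1,
  -- and comes back to 1.  The exit jump at E is separate from C because its target depends on x.
  program : ℕ → Program
  program x = dec 2 L L ∷ compile C 1 E ++ dec 2 (L + suc x) (L + suc x) ∷ load L x

  nth-nothing : ∀ p {o} → length p ≡ o → nth p o ≡ nothing
  nth-nothing []      refl = refl
  nth-nothing (_ ∷ p) refl = nth-nothing p refl

  length-load : ∀ o n → length (load o n) ≡ suc n
  length-load o zero    = refl
  length-load o (suc n) = cong suc (length-load (suc o) n)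

  reach-load : ∀ {p} n o pre → length pre ≡ o → p ≡ pre ++ load o n → ∀ y a R → R 0 ≡ 0 →
               ∃ λ S → Reach p o (y ◂ a ◂ R) 1 (y ◂ (n + a) ◂ S)
  reach-load zero    o pre len refl y a R eq = R , reach-dec-0 (nth-++ pre _ [] len) eq
  reach-load (suc n) o pre len refl y a R eq
    with reach-load n (suc o) (pre ++ inc 1 (suc o) ∷ []) (trans (length-++ pre) (trans (+-comm _ 1) (cong suc len)))
           (sym (++-assoc pre _ _)) y (suc a) R eq
  ... | S , r = S , reach-trans (reach-inc (nth-++ pre _ _ len))
                      (subst (λ k → Reach (pre ++ load o (suc n)) (suc o) (y ◂ suc a ◂ R) 1 (y ◂ k ◂ S)) (+-suc n a) r)

  prefix : Program
  prefix = dec 2 L L ∷ compile C 1 E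

  program-split : ∀ x → program x ≡ (prefix ++ dec 2 (L + suc x) (L + suc x) ∷ []) ++ load L x
  program-split x = cong (dec 2 L L ∷_) (sym (++-assoc (compile C 1 E) (_ ∷ []) (load L x)))

  length-prefix : length prefix ≡ E
  length-prefix = cong suc (length-compile C 1 E)

  length-split : ∀ x → length (prefix ++ dec 2 (L + suc x) (L + suc x) ∷ []) ≡ L
  length-split x = trans (length-++ prefix) (trans (+-comm _ 1) (cong suc length-prefix))

  program-at : ∀ x → At (program x) C 1 E
  program-at x = compile-at C (dec 2 L L ∷ []) (dec 2 (L + suc x) (L + suc x) ∷ load L x) refl

  program-halt : ∀ x → nth (program x) (L + suc x) ≡ nothing
  program-halt x = nth-nothing (program x) (trans (cong length (program-split x))
    (trans (length-++ (prefix ++ _ ∷ [])) (cong₂ _+_ (length-split x) (length-load L x))))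

  program-exit : ∀ x v S → Halts (program x) E (v ◂ S) v
  program-exit x v S = reach-halts (go (S 1) refl) (1 , run-halt 0 (program x) (L + suc x) _ (program-halt x))
    where
    at : nth (program x) E ≡ just (dec 2 (L + suc x) (L + suc x))
    at = nth-++ prefix _ (load L x) length-prefix
    go : ∀ m → S 1 ≡ m → Reach (program x) E (v ◂ S) (L + suc x) (v ◂ write 1 (pred m) S)
    go zero    eq = reach-cong (λ _ → refl) (λ { zero → refl ; (suc i) → write-same 1 S eq i }) (reach-dec-0 at eq)
    go (suc m) eq = reach-dec-suc at eq

  reach-start : ∀ x y → ∃ λ S → Reach (program x) 0 (input y) 1 (y ◂ x ◂ S)
  reach-start x y with reach-load x L _ (length-split x) (program-split x) y 0 (λ _ → 0) refl
  ... | S , r = S , reach-trans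
    (reach-cong {S = input y} (λ _ → refl) inp (reach-dec-0 {p = program x} {pc = 0} refl refl))
    (subst (λ k → Reach (program x) L (y ◂ 0 ◂ λ _ → 0) 1 (y ◂ k ◂ S)) (+-identityʳ x) r)
    where
    inp : input y ≗ (y ◂ 0 ◂ λ _ → 0)
    inp zero          = refl
    inp (suc zero)    = refl
    inp (suc (suc i)) = refl

-- Unbounded search

module Search {q : ℕ → ℕ} (qᵖ : PR q) where

  advance : ℕ → ℕ
  advance w = pair (fst w) (suc (snd w))

  advanceᵖ : PR advance
  advanceᵖ = pairᵖ fstᵖ (compᵖ sucᵖ sndᵖ)

  -- The argument `y` arrives in register 0 and the parameter `x` in register 1, so they are paired
  -- in the wrong order; this swaps them and adds the first candidate 0.
  start : ℕ → ℕ
  start u = pair (pair (snd u) (fst u)) 0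

  startᵖ : PR start
  startᵖ = pairᵖ (pairᵖ sndᵖ fstᵖ) zeroᵖ

  abstract
   -- Register 0 is the loop flag and register 1 holds the candidate. The test runs on a copy in
   -- register 3. On failure the flag is raised again; on success `ifdec` has already removed the
   -- unit from `suc v`, and `clear 0` changes nothing because the flag is down.
   prepare body output : Cmd
   prepare = pairC ⨾ cmd startᵖ ⨾ clear 1 ⨾ loop 0 (incr 1) ⨾ incr 0
   body    = shift dup ⨾ shift (shift (shift (cmd qᵖ))) ⨾
             ifdec 3 (incr 0 ⨾ shift (shift (cmd advanceᵖ)) ⨾ shift take1) (clear 0)
   output  = shift take2 ⨾ take1

   prepare⇝ : ∀ x y {R} → ∃ λ S → prepare ⊢ y ◂ x ◂ R ⇝ 1 ◂ pair (pair x y) 0 ◂ S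
   prepare⇝ x y {R} with pairC⇝ y x {R}
   ... | S , p with cmd-realises startᵖ (pair y x) S
   ... | T , t = _ , seq⇝ p (seq⇝ t (seq⇝ clear⇝ (seq⇝
     (subst (λ k → loop 0 (incr 1) ⊢ start (pair y x) ◂ 0 ◂ (λ i → T (suc i)) ⇝ 0 ◂ k ◂ (λ i → T (suc i)))
            (trans (+-identityʳ _) (cong₂ (λ a b → pair (pair a b) 0) (snd-pair y x) (fst-pair y x)))
            (move01⇝ (start (pair y x)) 0))
     incr⇝)))

   body-fail : ∀ w {R} → q w ≡ 0 → ∃ λ S → body ⊢ 0 ◂ w ◂ R ⇝ 1 ◂ advance w ◂ S
   body-fail w {R} eq with dup⇝ w {R}
   ... | S , d with cmd-realises qᵖ w S
   ... | T , t with cmd-realises advanceᵖ w (q w ◂ T)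
   ... | U , u = _ , seq⇝ (shift⇝ 0 d) (seq⇝ (shift⇝ 0 (shift⇝ 0 (shift⇝ w t)))
                 (zero⇝ eq (seq⇝ incr⇝ (seq⇝ (shift⇝ 1 (shift⇝ 0 u)) (shift⇝ 1 (take1⇝ 0 _))))))

   body-found : ∀ w {R v} → q w ≡ suc v → ∃ λ S → body ⊢ 0 ◂ w ◂ R ⇝ 0 ◂ 0 ◂ w ◂ v ◂ S
   body-found w {R} eq with dup⇝ w {R}
   ... | S , d with cmd-realises qᵖ w S
   ... | T , t = _ , seq⇝ (shift⇝ 0 d) (seq⇝ (shift⇝ 0 (shift⇝ 0 (shift⇝ w t))) (suc⇝ eq clear⇝))

   found⇝ : ∀ w {R v} → q w ≡ suc v → ∃ λ S → loop 0 body ⨾ output ⊢ 1 ◂ w ◂ R ⇝ v ◂ S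
   found⇝ w {R} eq with body-found w {R} eq
   ... | S , b = _ , seq⇝ (step⇝ refl b (done⇝ refl)) (seq⇝ (shift⇝ 0 (take2⇝ _ _ _)) (take1⇝ _ _))

  searchC : Cmd
  searchC = prepare ⨾ loop 0 body ⨾ output

  module _ {p : Program} {o k : ℕ} (at : At p (loop 0 body ⨾ output) o k) where

    reach-fail : ∀ w {R} → q w ≡ 0 → ∃ λ S → Reach p o (1 ◂ w ◂ R) o (1 ◂ advance w ◂ S)
    reach-fail w {R} eq with body-fail w {R} eq
    ... | S , b = S , reach-trans (reach-dec-suc (proj₁ (proj₁ at)) refl) (reach-cmd b (proj₂ (proj₁ at)))

    reach-found : ∀ w {R v} → q w ≡ suc v → ∃ λ S → Reach p o (1 ◂ w ◂ R) k (v ◂ S)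
    reach-found w {R} eq with found⇝ w {R} eq
    ... | S , b = S , reach-cmd b at

    module _ (exit : ∀ v S → Halts p k (v ◂ S) v) where

      search-halts : ∀ j w R {v} → q (iterate advance j w) ≡ suc v → ∃ λ v′ → Halts p o (1 ◂ w ◂ R) v′
      search-halts zero    w R eq with reach-found w {R} eq
      ... | S , r = _ , reach-halts r (exit _ S)
      search-halts (suc j) w R eq with q w in eq′
      ... | suc v with reach-found w {R} eq′
      ...   | S , r = _ , reach-halts r (exit _ S)
      search-halts (suc j) w R eq | zero with reach-fail w {R} eq′
      ...   | S , r with search-halts j (advance w) S eq
      ...     | v′ , h = v′ , reach-halts r h

      -- Strong induction on the fuel: a failed round costs at least one step. In a successful
      -- round, determinism of runs identifies the output.
      search-sound : ∀ f w R {v} → run f p o (1 ◂ w ◂ R) ≡ just v → ∃ λ j → q (iterate advance j w) ≡ suc v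
      search-sound = <-rec _ go
        where
        go : ∀ f → (∀ {g} → g < f → ∀ w R {v} → run g p o (1 ◂ w ◂ R) ≡ just v → ∃ λ j → q (iterate advance j w) ≡ suc v) →
             ∀ w R {v} → run f p o (1 ◂ w ◂ R) ≡ just v → ∃ λ j → q (iterate advance j w) ≡ suc v
        go f ih w R {v} h with q w in eq
        ... | zero with reach-fail w {R} eq
        ...   | S , r with reach-drop {f = f} r h
        ...     | g , g<f , h′ with ih g<f (advance w) S h′
        ...       | j , e = suc j , e
        go f ih w R {v} h | suc v′ with reach-found w {R} eq
        ...   | S , r with reach-drop {f = f} r h | exit v′ S
        ...     | g , _ , h′ | g′ , h″ = 0 , trans eq (cong suc (just-injective
                  (trans (sym (run-mono g′ (g ⊔ g′) p k _ (m≤n⊔m g g′) h″)) (run-mono g (g ⊔ g′) p k _ (m≤m⊔n g g′) h′))))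

  iterate-advance : ∀ j u z → iterate advance j (pair u z) ≡ pair u (j + z)
  iterate-advance zero    u z = refl
  iterate-advance (suc j) u z = trans (cong (iterate advance j) (cong₂ (λ a b → pair a (suc b)) (fst-pair u z) (snd-pair u z)))
    (trans (iterate-advance j u (suc z)) (cong (pair u) (+-suc j z)))

  open Loader searchC

  reach-search : ∀ x y → ∃ λ S → Reach (program x) 0 (input y) (1 + size prepare) (1 ◂ pair (pair x y) 0 ◂ S)
  reach-search x y with reach-start x y
  ... | S , r with prepare⇝ x y {S}
  ... | T , t = T , reach-trans r (reach-cmd t (proj₁ (program-at x)))

  program-halts : ∀ x y z {v} → q (pair (pair x y) z) ≡ suc v → ∃ λ v′ → Halts (program x) 0 (input y) v′
  program-halts x y z eq with reach-search x y
  ... | S , r with search-halts (proj₂ (program-at x)) (program-exit x) z (pair (pair x y) 0) S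
                     (trans (cong q (trans (iterate-advance z _ 0) (cong (pair _) (+-identityʳ z)))) eq)
  ... | v′ , h = v′ , reach-halts r h

  program-sound : ∀ x y {v} → Halts (program x) 0 (input y) v → ∃ λ z → q (pair (pair x y) z) ≡ suc v
  program-sound x y (f , h) with reach-search x y
  ... | S , r with reach-drop {f = f} r h
  ... | g , _ , h′ with search-sound (proj₂ (program-at x)) (program-exit x) g _ S h′
  ... | j , e = j + 0 , trans (cong q (sym (iterate-advance j _ 0))) e

-- Gödel numbers

encInstr : Instr → ℕ
encInstr (inc r j)   = pair 0 (pair r j)
encInstr (dec r j k) = pair 1 (pair r (pair j k))

consCode : ℕ → ℕ → ℕ
consCode i c = suc (pair i c)

encProgram : Program → ℕ
encProgram []      = 0
encProgram (i ∷ p) = consCode (encInstr i) (encProgram p)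

dec-enc-instr : ∀ i → decInstr (encInstr i) ≡ i
dec-enc-instr (inc r j) rewrite unpair-pair 0 (pair r j) | unpair-pair r j = refl
dec-enc-instr (dec r j k)
  rewrite unpair-pair 1 (pair r (pair j k)) | unpair-pair r (pair j k) | unpair-pair j k = refl

dec-enc : ∀ f p → encProgram p < f → decList f (encProgram p) ≡ p
dec-enc (suc f) []      lt = refl
dec-enc (suc f) (i ∷ p) (s≤s lt) rewrite unpair-pair (encInstr i) (encProgram p) =
  cong₂ _∷_ (dec-enc-instr i) (dec-enc f p (≤-trans (s≤s (snd≤pair (encInstr i) (encProgram p))) lt))

prog-enc : ∀ p → prog (encProgram p) ≡ p
prog-enc p = dec-enc _ p ≤-refl

consᵖ : ∀ {f g} → PR f → PR g → PR (λ x → consCode (f x) (g x))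
consᵖ f g = compᵖ sucᵖ (pairᵖ f g)

module _ {q : ℕ → ℕ} (qᵖ : PR q) where
  open Search qᵖ using (searchC)
  open Loader searchC

  -- Builds the loader from its end, as list codes grow at the front: the state is the address of
  -- the first instruction with the code from there on, and the prepended increment jumps to that
  -- address.
  loadStep : ℕ → ℕ
  loadStep s = pair (pred (fst s)) (consCode (pair 0 (pair 1 (fst s))) (snd s))

  loadStep-load : ∀ j o m → iterate loadStep j (pair (j + o) (encProgram (load (j + o) m))) ≡ pair o (encProgram (load o (j + m)))
  loadStep-load zero    o m = refl
  loadStep-load (suc j) o m = trans
    (cong (iterate loadStep j) (cong₂ (λ a b → pair (pred a) (consCode (pair 0 (pair 1 a)) b))
      (fst-pair (suc j + o) (encProgram (load (suc j + o) m))) (snd-pair (suc j + o) (encProgram (load (suc j + o) m)))))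
    (trans (loadStep-load j o (suc m)) (cong (λ k → pair o (encProgram (load o k))) (+-suc j m)))

  loadᵖ : PR (λ x → encProgram (load L x))
  loadᵖ = extᵖ (compᵖ sndᵖ (comp₂ᵖ {iterate loadStep} (iterᵖ (pairᵖ (predᵖ fstᵖ)
                (consᵖ (pairᵖ (constᵖ 0) (pairᵖ (constᵖ 1) fstᵖ)) sndᵖ))) idᵖ
                -- The last instruction of the loader does not mention its own address, so
                -- `load 0 0` stands for it everywhere.
                (pairᵖ (idᵖ +ᵖ constᵖ L) (constᵖ (encProgram (load 0 0))))))
          λ x → trans (cong snd (loadStep-load x L 0))
                  (trans (snd-pair L _) (cong (λ k → encProgram (load L k)) (+-identityʳ x)))

  prependᵖ : ∀ (p : Program) {r : ℕ → Program} → PR (λ x → encProgram (r x)) → PR (λ x → encProgram (p ++ r x))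
  prependᵖ []      rᵖ = rᵖ
  prependᵖ (i ∷ p) rᵖ = consᵖ (constᵖ (encInstr i)) (prependᵖ p rᵖ)

  programᵖ : PR (λ x → encProgram (program x))
  programᵖ = prependᵖ (dec 2 L L ∷ compile searchC 1 E)
    (consᵖ (pairᵖ (constᵖ 1) (pairᵖ (constᵖ 2) (pairᵖ target target))) loadᵖ)
    where
    target : PR (λ x → L + suc x)
    target = constᵖ L +ᵖ sucᵖ

abstract
  -- The parameter theorem and unbounded search in one: an index for `y ↦ v` where `suc v` is the
  -- value of `q` at the first `((x , y) , z)` at which `q` is not 0.
  smn : ∀ {q} → PR q → ℕ → ℕ
  smn qᵖ x = encProgram (Loader.program (Search.searchC qᵖ) x)

  smnᵖ : ∀ {q} (qᵖ : PR q) → PR (smn qᵖ)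
  smnᵖ qᵖ = programᵖ qᵖ

  -- The search may succeed before `z`, with another value, so the output is left open here;
  -- `smn-sound` pins it down when all successes agree.
  smn-halts : ∀ {q} (qᵖ : PR q) x y z {v} → q (pair (pair x y) z) ≡ suc v → ∃ λ v′ → smn qᵖ x · y ⇓ v′
  smn-halts qᵖ x y z {v} eq =
    subst (λ p → ∃ λ v′ → Halts p 0 (input y) v′) (sym (prog-enc (Loader.program (Search.searchC qᵖ) x))) (Search.program-halts qᵖ x y z eq)

  smn-sound : ∀ {q} (qᵖ : PR q) x y {v} → smn qᵖ x · y ⇓ v → ∃ λ z → q (pair (pair x y) z) ≡ suc v
  smn-sound qᵖ x y {v} h =
    Search.program-sound qᵖ x y (subst (λ p → Halts p 0 (input y) v) (prog-enc (Loader.program (Search.searchC qᵖ) x)) h)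

-- Streams coded by numbers

-- Unpairing never ends, so every number codes an infinite stream of heads and tails; 0 codes the
-- zero stream, since it unpairs to `(0 , 0)`.
lookupˢ : ℕ → ℕ → ℕ
lookupˢ i r = fst (iterate snd i r)

setˢ : ℕ → ℕ → ℕ → ℕ
setˢ zero    v r = pair v (snd r)
setˢ (suc i) v r = pair (fst r) (setˢ i v (snd r))

lookup-set : ∀ i v r j → update (λ k → lookupˢ k r) i v j ≡ lookupˢ j (setˢ i v r)
lookup-set zero    v r zero    = sym (fst-pair v (snd r))
lookup-set zero    v r (suc j) = cong (lookupˢ j) (sym (snd-pair v (snd r)))
lookup-set (suc i) v r zero    = sym (fst-pair (fst r) _)
lookup-set (suc i) v r (suc j) = trans (lookup-set i v (snd r) j)
  (cong (lookupˢ j) (sym (snd-pair (fst r) (setˢ i v (snd r)))))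

lookup-0 : ∀ i → lookupˢ i 0 ≡ 0
lookup-0 i = cong fst (iterate-fix snd i refl)

lookupᵖ : ∀ {i r} → PR i → PR r → PR (λ x → lookupˢ (i x) (r x))
lookupᵖ iᵖ rᵖ = compᵖ fstᵖ (comp₂ᵖ {iterate snd} (iterᵖ sndᵖ) iᵖ rᵖ)

-- setˢ is iterative on a zipper: a stack of the entries passed and the remaining stream.
module Zipper where

  down up : ℕ → ℕ
  down s = pair (pair (fst (snd s)) (fst s)) (snd (snd s))
  up   s = pair (snd (fst s)) (pair (fst (fst s)) (snd s))

  put : ℕ → ℕ → ℕ
  put v s = pair (fst s) (pair v (snd (snd s)))

  set-zipper : ∀ i v t r → iterate up i (put v (iterate down i (pair t r))) ≡ pair t (setˢ i v r)
  set-zipper zero    v t r = cong₂ (λ a b → pair a (pair v (snd b))) (fst-pair t r) (snd-pair t r)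
  set-zipper (suc i) v t r = trans (iterate-suc up i _) (trans
    (cong up (trans (cong (iterate up i ∘ put v ∘ iterate down i)
                      (cong₂ (λ a b → pair (pair (fst b) a) (snd b)) (fst-pair t r) (snd-pair t r)))
                    (set-zipper i v (pair (fst r) t) (snd r))))
    (trans (cong₂ (λ a b → pair (snd a) (pair (fst a) b)) (fst-pair (pair (fst r) t) _) (snd-pair (pair (fst r) t) _))
           (cong₂ (λ a b → pair a (pair b _)) (snd-pair (fst r) t) (fst-pair (fst r) t))))

  setᵖ : ∀ {i v r} → PR i → PR v → PR r → PR (λ x → setˢ (i x) (v x) (r x))
  setᵖ {i} {v} {r} iᵖ vᵖ rᵖ =
    extᵖ (compᵖ sndᵖ (comp₂ᵖ {iterate up} (iterᵖ upᵖ) iᵖ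
           (comp₂ᵖ {put} putᵖ vᵖ (comp₂ᵖ {iterate down} (iterᵖ downᵖ) iᵖ (pairᵖ zeroᵖ rᵖ)))))
         λ x → trans (cong snd (set-zipper (i x) (v x) 0 (r x))) (snd-pair 0 _)
    where
    downᵖ : PR down
    downᵖ = pairᵖ (pairᵖ (compᵖ fstᵖ sndᵖ) fstᵖ) (compᵖ sndᵖ sndᵖ)
    upᵖ : PR up
    upᵖ = pairᵖ (compᵖ sndᵖ fstᵖ) (pairᵖ (compᵖ fstᵖ fstᵖ) sndᵖ)
    putᵖ : PR₂ put
    putᵖ = pairᵖ (compᵖ fstᵖ sndᵖ) (pairᵖ fstᵖ (compᵖ sndᵖ (compᵖ sndᵖ sndᵖ)))

open Zipper using (setᵖ)

-- A primitive recursive interpreter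

tailCode : ℕ → ℕ
tailCode n = snd (pred n)

fetch : ℕ → Maybe Instr
fetch zero    = nothing
fetch (suc n) = just (decInstr (fst n))

-- Lets the interpreter read instructions off the code of the program, without decoding the list.
nth-decList : ∀ i f n → n < f → nth (decList f n) i ≡ fetch (iterate tailCode i n)
nth-decList i       (suc f) zero    lt rewrite iterate-fix tailCode i {0} refl = refl
nth-decList zero    (suc f) (suc n) lt = refl
nth-decList (suc i) (suc f) (suc n) (s≤s lt) = nth-decList i f (snd n) (≤-trans (s≤s (snd≤ n)) lt)

decInstr-inc : ∀ a → fst a ≡ 0 → decInstr a ≡ inc (fst (snd a)) (snd (snd a))
decInstr-inc a eq with unpair a
decInstr-inc a refl | zero , b = refl

decInstr-dec : ∀ a {m} → fst a ≡ suc m →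
               decInstr a ≡ dec (fst (snd a)) (fst (snd (snd a))) (snd (snd (snd a)))
decInstr-dec a eq with unpair a
decInstr-dec a refl | suc _ , b = refl

maybeCode : Maybe ℕ → ℕ
maybeCode nothing  = 0
maybeCode (just v) = suc v

maybeCode-suc : ∀ m {v} → maybeCode m ≡ suc v → m ≡ just v
maybeCode-suc (just v) refl = refl

execInstr : ℕ → ℕ → ℕ
execInstr a r = ifz (fst a)
  (pair (snd (snd a)) (setˢ (fst (snd a)) (suc (lookupˢ (fst (snd a)) r)) r))
  (ifz (lookupˢ (fst (snd a)) r)
       (pair (snd (snd (snd a))) r)
       (pair (fst (snd (snd a))) (setˢ (fst (snd a)) (pred (lookupˢ (fst (snd a)) r)) r)))

-- A configuration is `(h , (pc , r))` with `r` the stream of registers; `h` is 0 while running and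
-- one more than the output after halting, when the configuration stays fixed.
stepConfig : ℕ → ℕ → ℕ
stepConfig e s = ifz (fst s)
  (ifz c (pair (suc (lookupˢ 0 (snd (snd s)))) (snd s)) (pair 0 (execInstr (fst (pred c)) (snd (snd s)))))
  s
  where
  c = iterate tailCode (fst (snd s)) e

execInstrᵖ : ∀ {a r} → PR a → PR r → PR (λ x → execInstr (a x) (r x))
execInstrᵖ {a} {r} aᵖ rᵖ = ifzᵖ (compᵖ fstᵖ aᵖ)
  (pairᵖ (compᵖ sndᵖ (compᵖ sndᵖ aᵖ)) (setᵖ reg (compᵖ sucᵖ val) rᵖ))
  (ifzᵖ val (pairᵖ (compᵖ sndᵖ (compᵖ sndᵖ (compᵖ sndᵖ aᵖ))) rᵖ)
            (pairᵖ (compᵖ fstᵖ (compᵖ sndᵖ (compᵖ sndᵖ aᵖ))) (setᵖ reg (predᵖ val) rᵖ)))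
  where
  reg : PR (λ x → fst (snd (a x)))
  reg = compᵖ fstᵖ (compᵖ sndᵖ aᵖ)
  val : PR (λ x → lookupˢ (fst (snd (a x))) (r x))
  val = lookupᵖ reg rᵖ

stepConfigᵖ : PR₂ stepConfig
stepConfigᵖ = ifzᵖ (compᵖ fstᵖ sndᵖ)
  (ifzᵖ code (pairᵖ (compᵖ sucᵖ (lookupᵖ zeroᵖ regs)) (compᵖ sndᵖ sndᵖ))
             (pairᵖ zeroᵖ (execInstrᵖ (compᵖ fstᵖ (predᵖ code)) regs)))
  sndᵖ
  where
  regs : PR (λ x → snd (snd (snd x)))
  regs = compᵖ sndᵖ (compᵖ sndᵖ sndᵖ)
  code : PR (λ x → iterate tailCode (fst (snd (snd x))) (fst x))
  code = comp₂ᵖ {iterate tailCode} (iterᵖ (compᵖ sndᵖ (predᵖ idᵖ))) (compᵖ fstᵖ (compᵖ sndᵖ sndᵖ)) fstᵖ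

step-halted : ∀ e h s → stepConfig e (pair (suc h) s) ≡ pair (suc h) s
step-halted e h s rewrite fst-pair (suc h) s = refl

step-running : ∀ e pc r → stepConfig e (pair 0 (pair pc r)) ≡
  ifz (iterate tailCode pc e) (pair (suc (lookupˢ 0 r)) (pair pc r))
      (pair 0 (execInstr (fst (pred (iterate tailCode pc e))) r))
step-running e pc r rewrite fst-pair 0 (pair pc r) | snd-pair 0 (pair pc r) | fst-pair pc r | snd-pair pc r = refl

simulate : ∀ f e pc r →
  fst (iterate (stepConfig e) f (pair 0 (pair pc r))) ≡ maybeCode (run f (prog e) pc (λ i → lookupˢ i r))
simulate zero    e pc r = fst-pair 0 (pair pc r)
simulate (suc f) e pc r rewrite step-running e pc r = go _ (nth-decList pc (suc e) e ≤-refl)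
  where
  R : State
  R i = lookupˢ i r
  exec : ∀ a → nth (prog e) pc ≡ just (decInstr a) →
         fst (iterate (stepConfig e) f (pair 0 (execInstr a r))) ≡ maybeCode (run (suc f) (prog e) pc R)
  exec a at with fst a in eq
  ... | zero = trans (simulate f e _ _) (cong maybeCode (sym (trans
        (run-inc f (prog e) pc R (trans at (cong just (decInstr-inc a eq))))
        (run-cong f (prog e) _ (lookup-set (fst (snd a)) _ r)))))
  ... | suc _ with lookupˢ (fst (snd a)) r in eq′
  ...   | zero  = trans (simulate f e _ _) (cong maybeCode (sym
        (run-dec-0 f (prog e) pc R (trans at (cong just (decInstr-dec a eq))) eq′)))
  ...   | suc m = trans (simulate f e _ _) (cong maybeCode (sym (trans
        (run-dec-suc f (prog e) pc R (trans at (cong just (decInstr-dec a eq))) eq′)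
        (run-cong f (prog e) _ (lookup-set (fst (snd a)) m r)))))
  go : ∀ c → nth (prog e) pc ≡ fetch c →
       fst (iterate (stepConfig e) f (ifz c (pair (suc (lookupˢ 0 r)) (pair pc r)) (pair 0 (execInstr (fst (pred c)) r))))
       ≡ maybeCode (run (suc f) (prog e) pc R)
  go zero    at = trans (cong fst (iterate-fix (stepConfig e) f (step-halted e _ _)))
                    (trans (fst-pair _ _) (cong maybeCode (sym (run-halt f (prog e) pc R at))))
  go (suc n) at = exec (fst n) at

abstract
  runFor : ℕ → ℕ → ℕ → ℕ
  runFor f e x = maybeCode (run f (prog e) 0 (input x))

  runFor-sound : ∀ f e x {v} → runFor f e x ≡ suc v → e · x ⇓ v
  runFor-sound f e x eq = f , maybeCode-suc _ eq

  runFor-complete : ∀ {e x v} → e · x ⇓ v → ∃ λ f → runFor f e x ≡ suc v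
  runFor-complete (f , eq) = f , cong maybeCode eq

  runFor-mono : ∀ f g e x {v} → f ≤ g → runFor f e x ≡ suc v → runFor g e x ≡ suc v
  runFor-mono f g e x f≤g eq = cong maybeCode (run-mono f g (prog e) 0 (input x) f≤g (maybeCode-suc _ eq))

  runForᵖ : ∀ {f e x} → PR f → PR e → PR x → PR (λ y → runFor (f y) (e y) (x y))
  runForᵖ {f} {e} {x} fᵖ eᵖ xᵖ = extᵖ
    (compᵖ fstᵖ (iter₂ᵖ {stepConfig} stepConfigᵖ eᵖ fᵖ (pairᵖ zeroᵖ (pairᵖ zeroᵖ (pairᵖ xᵖ zeroᵖ)))))
    λ y → trans (simulate (f y) (e y) 0 (pair (x y) 0)) (cong maybeCode (run-cong (f y) (prog (e y)) 0 (inp (x y))))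
    where
    inp : ∀ x i → lookupˢ i (pair x 0) ≡ input x i
    inp x zero    = fst-pair x 0
    inp x (suc i) = trans (cong (lookupˢ i) (snd-pair x 0)) (lookup-0 i)

·⇓-det : ∀ {e x v w} → e · x ⇓ v → e · x ⇓ w → v ≡ w
·⇓-det {e} {x} (f , p) (g , q) = just-injective (trans
  (sym (run-mono f (f ⊔ g) (prog e) 0 (input x) (m≤m⊔n f g) p)) (run-mono g (f ⊔ g) (prog e) 0 (input x) (m≤n⊔m f g) q))

-- Evaluation of terms

applyFor : ℕ → ℕ → ℕ → ℕ
applyFor f a b = ifz a 0 (ifz b 0 (runFor f (pred a) (pred b)))

evalFor : ℕ → Term → ℕ
evalFor f (el n)    = suc n
evalFor f (app s t) = applyFor f (evalFor f s) (evalFor f t)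

evalFor-sound : ∀ f t {v} → evalFor f t ≡ suc v → t ⇓ v
evalFor-sound f (el n) refl = el⇓
evalFor-sound f (app s t) eq with evalFor f s in p | evalFor f t in q
... | suc a | suc b = app⇓ (evalFor-sound f s p) (evalFor-sound f t q) (runFor-sound f a b eq)

evalFor-mono : ∀ f g t {v} → f ≤ g → evalFor f t ≡ suc v → evalFor g t ≡ suc v
evalFor-mono f g (el n) f≤g eq = eq
evalFor-mono f g (app s t) f≤g eq with evalFor f s in p | evalFor f t in q
... | suc a | suc b rewrite evalFor-mono f g s f≤g p | evalFor-mono f g t f≤g q = runFor-mono f g a b f≤g eq

evalFor-complete : ∀ {t v} → t ⇓ v → ∃ λ f → evalFor f t ≡ suc v
evalFor-complete el⇓ = 0 , refl
evalFor-complete (app⇓ {s} {t} {a} {b} p q r)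
  with evalFor-complete p | evalFor-complete q | runFor-complete r
... | f , p′ | g , q′ | h , r′ = n , eq
  where
  n = f ⊔ g ⊔ h
  eq : applyFor n (evalFor n s) (evalFor n t) ≡ suc _
  eq rewrite evalFor-mono f n s (≤-trans (m≤m⊔n f g) (m≤m⊔n (f ⊔ g) h)) p′
           | evalFor-mono g n t (≤-trans (m≤n⊔m f g) (m≤m⊔n (f ⊔ g) h)) q′
           = runFor-mono h n a b (m≤n⊔m (f ⊔ g) h) r′

⇓-det : ∀ {t v w} → t ⇓ v → t ⇓ w → v ≡ w
⇓-det el⇓ el⇓ = refl
⇓-det (app⇓ p q r) (app⇓ p′ q′ r′) with ⇓-det p p′ | ⇓-det q q′
... | refl | refl = ·⇓-det r r′

-- Term codes

parity-inj₁ : ∀ n {m} → parity n ≡ inj₁ m → n ≡ m + m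
parity-inj₂ : ∀ n {m} → parity n ≡ inj₂ m → n ≡ suc (m + m)
parity-inj₁ zero refl = refl
parity-inj₁ (suc n) eq with parity n in p
parity-inj₁ (suc n) refl | inj₂ m = cong suc (trans (parity-inj₂ n p) (sym (+-suc m m)))
parity-inj₂ (suc n) eq with parity n in p
parity-inj₂ (suc n) refl | inj₁ m = cong suc (parity-inj₁ n p)

parity-double : ∀ m → parity (m + m) ≡ inj₁ m
parity-double zero = refl
parity-double (suc m) rewrite +-suc m m | parity-double m = refl

parity-suc-double : ∀ m → parity (suc (m + m)) ≡ inj₂ m
parity-suc-double m rewrite parity-double m = refl

half< : ∀ n {m} → parity n ≡ inj₂ m → m < n
half< n {m} eq = subst (m <_) (sym (parity-inj₂ n eq)) (s≤s (m≤m+n m m))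

decT-fuel : ∀ f g n → n < f → n < g → decT f n ≡ decT g n
decT-fuel (suc f) (suc g) n (s≤s n≤f) (s≤s n≤g) with parity n in eq
... | inj₁ m = refl
... | inj₂ m = cong₂ app
  (decT-fuel f g _ (≤-trans (≤-trans (s≤s (fst≤ m)) (half< n eq)) n≤f) (≤-trans (≤-trans (s≤s (fst≤ m)) (half< n eq)) n≤g))
  (decT-fuel f g _ (≤-trans (≤-trans (s≤s (snd≤ m)) (half< n eq)) n≤f) (≤-trans (≤-trans (s≤s (snd≤ m)) (half< n eq)) n≤g))

decodeTerm-el : ∀ n {m} → parity n ≡ inj₁ m → decodeTerm n ≡ el m
decodeTerm-el n eq rewrite eq = refl

decodeTerm-app : ∀ n {m} → parity n ≡ inj₂ m → decodeTerm n ≡ app (decodeTerm (fst m)) (decodeTerm (snd m))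
decodeTerm-app n {m} eq with half< n eq
... | lt rewrite eq = cong₂ app (decT-fuel n _ _ (≤-trans (s≤s (fst≤ m)) lt) ≤-refl)
                                (decT-fuel n _ _ (≤-trans (s≤s (snd≤ m)) lt) ≤-refl)

elCode : ℕ → ℕ
elCode n = n + n

appCode : ℕ → ℕ → ℕ
appCode a b = suc (pair a b + pair a b)

decode-elCode : ∀ n → decodeTerm (elCode n) ≡ el n
decode-elCode n = decodeTerm-el (n + n) (parity-double n)

decode-appCode : ∀ a b → decodeTerm (appCode a b) ≡ app (decodeTerm a) (decodeTerm b)
decode-appCode a b = trans (decodeTerm-app (appCode a b) (parity-suc-double (pair a b)))
  (cong₂ (λ u v → app (decodeTerm u) (decodeTerm v)) (fst-pair a b) (snd-pair a b))

parityStep : ℕ → ℕ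
parityStep s = ifz (fst s) (pair 1 (snd s)) (pair 0 (suc (snd s)))

sumCode : ℕ ⊎ ℕ → ℕ
sumCode (inj₁ m) = pair 0 m
sumCode (inj₂ m) = pair 1 m

parityᵖ : PR (λ n → sumCode (parity n))
parityᵖ = extᵖ (comp₂ᵖ {iterate parityStep} (iterᵖ stepᵖ) idᵖ (pairᵖ zeroᵖ zeroᵖ)) go
  where
  stepᵖ : PR parityStep
  stepᵖ = ifzᵖ fstᵖ (pairᵖ (constᵖ 1) sndᵖ) (pairᵖ zeroᵖ (compᵖ sucᵖ sndᵖ))
  go : ∀ n → iterate parityStep n (pair 0 0) ≡ sumCode (parity n)
  go zero    = refl
  go (suc n) rewrite iterate-suc parityStep n (pair 0 0) | go n with parity n
  ... | inj₁ m rewrite fst-pair 0 m | snd-pair 0 m = refl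
  ... | inj₂ m rewrite fst-pair 1 m | snd-pair 1 m = refl

-- The step of a course-of-values recursion: both subterms have codes below `n`, so their values are
-- in the table.
evalEntry : ℕ → ℕ → ℕ → ℕ
evalEntry f n tab = ifz (fst p) (suc (snd p)) (applyFor f (lookupˢ (fst (snd p)) tab) (lookupˢ (snd (snd p)) tab))
  where
  p = sumCode (parity n)

-- Extends a table of the values of the terms with codes < n, kept in a pair with n.
extend : ℕ → ℕ → ℕ
extend f s = pair (suc (fst s)) (setˢ (fst s) (evalEntry f (fst s) (snd s)) (snd s))

Table : ℕ → ℕ → ℕ → Set
Table f n s = fst s ≡ n × (∀ i → i < n → lookupˢ i (snd s) ≡ evalFor f (decodeTerm i))

evalEntry-correct : ∀ f n tab → (∀ i → i < n → lookupˢ i tab ≡ evalFor f (decodeTerm i)) →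
                    evalEntry f n tab ≡ evalFor f (decodeTerm n)
evalEntry-correct f n tab ok = go (parity n) refl
  where
  go : ∀ u → parity n ≡ u →
       ifz (fst (sumCode u)) (suc (snd (sumCode u)))
           (applyFor f (lookupˢ (fst (snd (sumCode u))) tab) (lookupˢ (snd (snd (sumCode u))) tab))
       ≡ evalFor f (decodeTerm n)
  go (inj₁ m) eq rewrite decodeTerm-el n eq | fst-pair 0 m | snd-pair 0 m = refl
  go (inj₂ m) eq rewrite decodeTerm-app n eq | fst-pair 1 m | snd-pair 1 m =
    cong₂ (applyFor f) (ok (fst m) (≤-trans (s≤s (fst≤ m)) (half< n eq))) (ok (snd m) (≤-trans (s≤s (snd≤ m)) (half< n eq)))

update-same : ∀ R i v → update R i v i ≡ v
update-same R zero    v = refl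
update-same R (suc i) v = update-same (R ∘ suc) i v

update-other : ∀ R i v j → ¬ j ≡ i → update R i v j ≡ R j
update-other R zero    v zero    ne = ⊥-elim (ne refl)
update-other R zero    v (suc j) ne = refl
update-other R (suc i) v zero    ne = refl
update-other R (suc i) v (suc j) ne = update-other (R ∘ suc) i v j (ne ∘ cong suc)

extend-table : ∀ f n s → Table f n s → Table f (suc n) (extend f s)
extend-table f .(fst s) s (refl , ok) = fst-pair _ _ , λ i lt → trans (cong (lookupˢ i) (snd-pair _ _))
  (trans (sym (lookup-set n e (snd s) i)) (go i (≤⇒≤′ lt)))
  where
  n e : ℕ
  n = fst s
  e = evalEntry f n (snd s)
  go : ∀ i → i <′ suc n → update (λ k → lookupˢ k (snd s)) n e i ≡ evalFor f (decodeTerm i)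
  go i ≤′-refl       = trans (update-same _ n e) (evalEntry-correct f n (snd s) ok)
  go i (≤′-step lt) = trans (update-other _ n e i (<⇒≢ (≤′⇒≤ lt))) (ok i (≤′⇒≤ lt))

table : ∀ f n → Table f n (iterate (extend f) n (pair 0 0))
table f zero    = fst-pair 0 0 , λ i ()
table f (suc n) rewrite iterate-suc (extend f) n (pair 0 0) = extend-table f n (iterate (extend f) n (pair 0 0)) (table f n)

evalᵖ : ∀ {f c} → PR f → PR c → PR (λ x → evalFor (f x) (decodeTerm (c x)))
evalᵖ {f} {c} fᵖ cᵖ = extᵖ
  (lookupᵖ cᵖ (compᵖ sndᵖ (iter₂ᵖ {extend} extendᵖ fᵖ (compᵖ sucᵖ cᵖ) (pairᵖ zeroᵖ zeroᵖ))))
  λ x → proj₂ (table (f x) (suc (c x))) (c x) ≤-refl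
  where
  applyᵖ : ∀ {f a b} → PR f → PR a → PR b → PR (λ x → applyFor (f x) (a x) (b x))
  applyᵖ fᵖ aᵖ bᵖ = ifzᵖ aᵖ zeroᵖ (ifzᵖ bᵖ zeroᵖ (runForᵖ fᵖ (predᵖ aᵖ) (predᵖ bᵖ)))
  extendᵖ : PR₂ extend
  extendᵖ = pairᵖ (compᵖ sucᵖ idx) (setᵖ idx
    (ifzᵖ (compᵖ fstᵖ par) (compᵖ sucᵖ (compᵖ sndᵖ par))
      (applyᵖ fstᵖ (lookupᵖ (compᵖ fstᵖ (compᵖ sndᵖ par)) tab) (lookupᵖ (compᵖ sndᵖ (compᵖ sndᵖ par)) tab))) tab)
    where
    idx : PR (λ x → fst (snd x))
    idx = compᵖ fstᵖ sndᵖ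
    tab : PR (λ x → snd (snd x))
    tab = compᵖ sndᵖ sndᵖ
    par : PR (λ x → sumCode (parity (fst (snd x))))
    par = compᵖ parityᵖ idx

infixr 1 _⟫_
_⟫_ : ∀ {A B C : Set} → A ⇔ B → B ⇔ C → A ⇔ C
p ⟫ q = q ⇔-∘ p

≡⇔ : {A B : Set} → A ≡ B → A ⇔ B
≡⇔ = ≡⇒

-- Computable indices

-- A test that every candidate passes reduces the search to the evaluation of `g`.
curryᵖ : ∀ {g} → PR g → PR (λ w → suc (g (fst w)))
curryᵖ gᵖ = compᵖ sucᵖ (compᵖ gᵖ fstᵖ)

curryIndex : ∀ {g} → PR g → ℕ → ℕ
curryIndex gᵖ = smn (curryᵖ gᵖ)

curryIndex⇓ : ∀ {g} (gᵖ : PR g) x y → curryIndex gᵖ x · y ⇓ g (pair x y)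
curryIndex⇓ {g} gᵖ x y with smn-halts (curryᵖ gᵖ) x y 0 refl
... | v , h with smn-sound (curryᵖ gᵖ) x y h
... | z , eq = subst (curryIndex gᵖ x · y ⇓_) (trans (sym (suc-injective eq)) (cong g (fst-pair (pair x y) z))) h

index : ∀ {f} → PR f → ℕ
index fᵖ = curryIndex (compᵖ fᵖ sndᵖ) 0

index⇓ : ∀ {f} (fᵖ : PR f) x → index fᵖ · x ⇓ f x
index⇓ {f} fᵖ x = subst (λ k → index fᵖ · x ⇓ f k) (snd-pair 0 x) (curryIndex⇓ (compᵖ fᵖ sndᵖ) 0 x)

-- The search variable is the step bound, so the search simulates the application until it halts.
universalᵖ : ∀ {a b} → PR a → PR b → PR (λ w → runFor (snd w) (a (fst w)) (b (fst w)))
universalᵖ aᵖ bᵖ = runForᵖ sndᵖ (compᵖ aᵖ fstᵖ) (compᵖ bᵖ fstᵖ)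

universal : ∀ {a b} → PR a → PR b → ℕ → ℕ
universal aᵖ bᵖ = smn (universalᵖ aᵖ bᵖ)

universal-sound : ∀ {a b} (aᵖ : PR a) (bᵖ : PR b) x y {v} →
                  universal aᵖ bᵖ x · y ⇓ v → a (pair x y) · b (pair x y) ⇓ v
universal-sound {a} {b} aᵖ bᵖ x y h with smn-sound (universalᵖ aᵖ bᵖ) x y h
... | z , eq rewrite fst-pair (pair x y) z = runFor-sound _ _ _ eq

universal-complete : ∀ {a b} (aᵖ : PR a) (bᵖ : PR b) x y {v} →
                     a (pair x y) · b (pair x y) ⇓ v → universal aᵖ bᵖ x · y ⇓ v
universal-complete {a} {b} aᵖ bᵖ x y {v} h with runFor-complete h
... | f , eq with smn-halts (universalᵖ aᵖ bᵖ) x y f {v}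
                    (trans (cong₂ (λ g u → runFor g (a u) (b u)) (snd-pair (pair x y) f) (fst-pair (pair x y) f)) eq)
... | v′ , h′ = subst (universal aᵖ bᵖ x · y ⇓_) (·⇓-det (universal-sound aᵖ bᵖ x y h′) h) h′

-- Closure properties of the arithmetical classes

computable-zeros : ∀ {p} → PR p → Computable (λ x → p x ≡ 0)
computable-zeros {p} pᵖ = index testᵖ , λ x → go x (p x) refl
  where
  testᵖ : PR (λ x → ifz (p x) 1 0)
  testᵖ = ifzᵖ pᵖ (constᵖ 1) (constᵖ 0)
  go : ∀ x u → p x ≡ u → (p x ≡ 0 × index testᵖ · x ⇓ 1) ⊎ (¬ p x ≡ 0 × index testᵖ · x ⇓ 0)
  go x zero    eq = inj₁ (eq , subst (λ k → index testᵖ · x ⇓ ifz k 1 0) eq (index⇓ testᵖ x))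
  go x (suc u) eq = inj₂ ((λ eq′ → 0≢1+n (trans (sym eq′) eq)) ,
                          subst (λ k → index testᵖ · x ⇓ ifz k 1 0) eq (index⇓ testᵖ x))

computable-sub : ∀ {P f} → PR f → Computable P → Computable (P ∘ f)
computable-sub {P} {f} fᵖ (e , test) = e′ , go
  where
  e′ : ℕ
  e′ = universal (constᵖ e) (compᵖ fᵖ sndᵖ) 0
  lift⇓ : ∀ x {v} → e · f x ⇓ v → e′ · x ⇓ v
  lift⇓ x h = universal-complete (constᵖ e) (compᵖ fᵖ sndᵖ) 0 x (subst (λ k → e · f k ⇓ _) (sym (snd-pair 0 x)) h)
  go : ∀ x → (P (f x) × e′ · x ⇓ 1) ⊎ (¬ P (f x) × e′ · x ⇓ 0)
  go x with test (f x)
  ... | inj₁ (p , h) = inj₁ (p , lift⇓ x h)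
  ... | inj₂ (p , h) = inj₂ (p , lift⇓ x h)

pair⇓-pair : ∀ {c x y} → pair⇓ c x y → c ≡ pair x y
pair⇓-pair {c} eq = trans (sym (pair-unpair c)) (cong₂ pair (cong proj₁ eq) (cong proj₂ eq))

Σ-intro : ∀ {n P Q} → Π⁰ n Q → (∀ x → P x ⇔ (∃ λ y → Q (pair x y))) → Σ⁰ (suc n) P
Σ-intro {Q = Q} q eqv = Q , q , λ x → eqv x ⟫ mk⇔ (λ (y , h) → y , pair x y , unpair-pair x y , h)
                                               (λ (y , c , eq , h) → y , subst Q (pair⇓-pair eq) h)

Σ-elim : ∀ {n P} → Σ⁰ (suc n) P → Σ (ℕ → Set) λ Q → Π⁰ n Q × (∀ x → P x ⇔ (∃ λ y → Q (pair x y)))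
Σ-elim (Q , q , eqv) = Q , q , λ x → eqv x ⟫ mk⇔ (λ (y , c , eq , h) → y , subst Q (pair⇓-pair eq) h)
                                             (λ (y , h) → y , pair x y , unpair-pair x y , h)

Π-intro : ∀ {n P Q} → Σ⁰ n Q → (∀ x → P x ⇔ (∀ y → Q (pair x y))) → Π⁰ (suc n) P
Π-intro {Q = Q} q eqv = Q , q , λ x → eqv x ⟫ mk⇔ (λ h y c eq → subst Q (sym (pair⇓-pair eq)) (h y))
                                               (λ h y → h y (pair x y) (unpair-pair x y))

Π-elim : ∀ {n P} → Π⁰ (suc n) P → Σ (ℕ → Set) λ Q → Σ⁰ n Q × (∀ x → P x ⇔ (∀ y → Q (pair x y)))
Π-elim (Q , q , eqv) = Q , q , λ x → eqv x ⟫ mk⇔ (λ h y → h y (pair x y) (unpair-pair x y))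
                                             (λ h y c eq → subst Q (sym (pair⇓-pair eq)) (h y))

first : (ℕ → ℕ) → ℕ → ℕ
first f c = pair (f (fst c)) (snd c)

firstᵖ : ∀ {f} → PR f → PR (first f)
firstᵖ fᵖ = pairᵖ (compᵖ fᵖ fstᵖ) sndᵖ

first-pair : ∀ f x y → first f (pair x y) ≡ pair (f x) y
first-pair f x y = cong₂ (λ a b → pair (f a) b) (fst-pair x y) (snd-pair x y)

Σ-sub : ∀ n {P f} → PR f → Σ⁰ n P → Σ⁰ n (P ∘ f)
Π-sub : ∀ n {P f} → PR f → Π⁰ n P → Π⁰ n (P ∘ f)
Σ-sub zero    fᵖ (lift c) = lift (computable-sub fᵖ c)
Σ-sub (suc n) {P} {f} fᵖ p with Σ-elim p
... | Q , q , eqv = Σ-intro (Π-sub n (firstᵖ fᵖ) q) λ x → eqv (f x) ⟫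
  mk⇔ (λ (y , h) → y , subst Q (sym (first-pair f x y)) h) (λ (y , h) → y , subst Q (first-pair f x y) h)
Π-sub zero    fᵖ (lift c) = lift (computable-sub fᵖ c)
Π-sub (suc n) {P} {f} fᵖ p with Π-elim p
... | Q , q , eqv = Π-intro (Σ-sub n (firstᵖ fᵖ) q) λ x → eqv (f x) ⟫
  mk⇔ (λ h y → subst Q (sym (first-pair f x y)) (h y)) (λ h y → subst Q (first-pair f x y) (h y))

Π-cong : ∀ {n P P′} → (∀ x → P′ x ⇔ P x) → Π⁰ (suc n) P → Π⁰ (suc n) P′
Π-cong e p with Π-elim p
... | Q , q , eqv = Π-intro q λ x → e x ⟫ eqv x

-- The relations sim

-- Kleene equality as two inclusions. Unlike `≃`, it does not choose between defined and undefined,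
-- so it follows directly from soundness and completeness of an index.
_≅_ : Term → Term → Set
s ≅ t = (∀ {v} → s ⇓ v → t ⇓ v) × (∀ {v} → t ⇓ v → s ⇓ v)

≅-refl : ∀ {s} → s ≅ s
≅-refl = (λ h → h) , (λ h → h)

≅-sym : ∀ {s t} → s ≅ t → t ≅ s
≅-sym (f , g) = g , f

≅-app : ∀ {s t} x → s ≅ t → app s (el x) ≅ app t (el x)
≅-app x (f , g) = (λ { (app⇓ p q r) → app⇓ (f p) q r }) , (λ { (app⇓ p q r) → app⇓ (g p) q r })

-- sim is defined by cases on its first argument, so this does not hold by computation.
sim-suc : ∀ k n {s t} → sim k (suc n) s t ⇔ (∀ x → sim k n (app s (el x)) (app t (el x)))
sim-suc zero    n = mk⇔ (λ h → h) (λ h → h)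
sim-suc (suc k) n = mk⇔ (λ h → h) (λ h → h)

sim-resp   : ∀ k n {s s′ t t′} → s ≅ s′ → t ≅ t′ → sim k n s t → sim k n s′ t′
below-resp : ∀ k {s s′ t t′} → s ≅ s′ → t ≅ t′ → below k s t → below k s′ t′
sim-resp zero    zero (f , g) (f′ , g′) (inj₁ (a , b)) =
  inj₁ ((λ (v , h) → a (v , g h)) , λ (v , h) → b (v , g′ h))
sim-resp zero    zero (f , g) (f′ , g′) (inj₂ (v , a , b)) = inj₂ (v , f a , f′ b)
sim-resp (suc k) zero p q h   = below-resp (suc k) p q h
sim-resp k (suc n) p q h      = from (sim-suc k n) λ x → sim-resp k n (≅-app x p) (≅-app x q) (to (sim-suc k n) h x)
below-resp (suc k) p q (inj₁ h)       = inj₁ (below-resp k p q h)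
below-resp (suc k) p q (inj₂ (m , h)) = inj₂ (m , sim-resp k m p q h)

sim-≅ : ∀ k n {s s′ t t′} → s ≅ s′ → t ≅ t′ → sim k n s t ⇔ sim k n s′ t′
sim-≅ k n p q = mk⇔ (sim-resp k n p q) (sim-resp k n (≅-sym p) (≅-sym q))

-- For positive `k`, the levels below `ω k` need no separate case: together they are the relation at
-- `ω k`, which is `m = 0`.
sim-limit : ∀ k {s t} → sim (suc k) 0 s t ⇔ (∃ λ m → sim k m s t)
sim-limit k {s} {t} = mk⇔ (go k) inj₂
  where
  go : ∀ k → below (suc k) s t → ∃ λ m → sim k m s t
  go (suc k) (inj₁ h) = 0 , h
  go k       (inj₂ h) = h

-- Membership in the classes

applyBoth : ℕ → ℕ → ℕ
applyBoth x u = pair (appCode (fst u) (elCode x)) (appCode (snd u) (elCode x))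

applyStep : ℕ → ℕ
applyStep s = pair (snd (fst s)) (applyBoth (fst (fst s)) (snd s))

-- Applies the pair of terms u to the first n entries of the stream y.
applyMany : ℕ → ℕ → ℕ → ℕ
applyMany n y u = snd (iterate applyStep n (pair y u))

applyMany-suc : ∀ n y u → applyMany (suc n) y u ≡ applyMany n (snd y) (applyBoth (fst y) u)
applyMany-suc n y u = cong (snd ∘ iterate applyStep n)
  (cong₂ (λ a b → pair (snd a) (applyBoth (fst a) b)) (fst-pair y u) (snd-pair y u))

applyManyᵖ : ∀ {n y u} → PR n → PR y → PR u → PR (λ x → applyMany (n x) (y x) (u x))
applyManyᵖ nᵖ yᵖ uᵖ = compᵖ sndᵖ (comp₂ᵖ {iterate applyStep} (iterᵖ stepᵖ) nᵖ (pairᵖ yᵖ uᵖ))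
  where
  appCodeᵖ : ∀ {a b} → PR a → PR b → PR (λ x → appCode (a x) (elCode (b x)))
  appCodeᵖ aᵖ bᵖ = compᵖ sucᵖ (p +ᵖ p)
    where p = pairᵖ aᵖ (bᵖ +ᵖ bᵖ)
  stepᵖ : PR applyStep
  stepᵖ = pairᵖ (compᵖ sndᵖ fstᵖ)
    (pairᵖ (appCodeᵖ (compᵖ fstᵖ sndᵖ) (compᵖ fstᵖ fstᵖ)) (appCodeᵖ (compᵖ sndᵖ sndᵖ) (compᵖ fstᵖ fstᵖ)))

decode-applyBoth : ∀ k n x u → SimSet k n (applyBoth x u) ≡
  sim k n (app (decodeTerm (fst u)) (el x)) (app (decodeTerm (snd u)) (el x))
decode-applyBoth k n x u = cong₂ (sim k n) (eq (fst-pair _ _)) (eq (snd-pair _ _))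
  where
  eq : ∀ {c a} → c ≡ appCode a (elCode x) → decodeTerm c ≡ app (decodeTerm a) (el x)
  eq {a = a} refl = trans (decode-appCode a (elCode x)) (cong (app (decodeTerm a)) (decode-elCode x))

-- One stream supplies any number of arguments, so `n` universal quantifiers count as one, also when
-- `n` is itself a variable.
SimSet-applyMany : ∀ k n u → SimSet k n u ⇔ (∀ y → SimSet k 0 (applyMany n y u))
SimSet-applyMany k zero    u = mk⇔ (λ h y → subst (SimSet k 0) (sym (snd-pair y u)) h)
                                   (λ h → subst (SimSet k 0) (snd-pair 0 u) (h 0))
SimSet-applyMany k (suc n) u = mk⇔
  (λ h y → subst (SimSet k 0) (sym (applyMany-suc n y u))
     (to (SimSet-applyMany k n (applyBoth (fst y) u)) (from (≡⇔ (decode-applyBoth k n (fst y) u)) (to (sim-suc k n) h (fst y))) (snd y)))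
  (λ h → from (sim-suc k n) λ x → to (≡⇔ (decode-applyBoth k n x u)) (from (SimSet-applyMany k n (applyBoth x u)) λ y →
     subst (SimSet k 0) (trans (applyMany-suc n (pair x y) u)
       (cong₂ (λ a b → applyMany n a (applyBoth b u)) (snd-pair x y) (fst-pair x y))) (h (pair x y))))

-- `f` bounds the steps of a challenge and `g` those of the answer: a value that one side shows
-- within `f` steps must be shown by the other within `g`. The result 0 means that both directions
-- pass.
≃-test : ℕ → ℕ → ℕ → ℕ → ℕ
≃-test f g a b = ifz (A f a) 0 (differ (A f a) (A g b)) + ifz (A f b) 0 (differ (A f b) (A g a))
  where
  A : ℕ → ℕ → ℕ
  A f c = evalFor f (decodeTerm c)

≃-testᵖ : ∀ {f g a b} → PR f → PR g → PR a → PR b → PR (λ x → ≃-test (f x) (g x) (a x) (b x))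
≃-testᵖ fᵖ gᵖ aᵖ bᵖ = ifzᵖ (evalᵖ fᵖ aᵖ) zeroᵖ (differᵖ (evalᵖ fᵖ aᵖ) (evalᵖ gᵖ bᵖ)) +ᵖ
                      ifzᵖ (evalᵖ fᵖ bᵖ) zeroᵖ (differᵖ (evalᵖ fᵖ bᵖ) (evalᵖ gᵖ aᵖ))

double : ℕ → ℕ
double zero    = 0
double (suc k) = suc (suc (double k))

2*≡double : ∀ k → 2 * k ≡ double k
2*≡double zero    = refl
2*≡double (suc k) = trans (*-suc 2 k) (cong (suc ∘ suc) (2*≡double k))

module Classical (em : ExcludedMiddle 0ℓ) where

  dne : {A : Set} → ¬ ¬ A → A
  dne = em⇒dne em

  ¬∀⇒∃¬ : {P : ℕ → Set} → ¬ (∀ y → P y) → ∃ λ y → ¬ P y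
  ¬∀⇒∃¬ h = dne λ k → h λ y → dne λ p → k (y , p)

  ≃-arith : ∀ a b → decodeTerm a ≃ decodeTerm b ⇔ (∀ f → ∃ λ g → ≃-test f g a b ≡ 0)
  ≃-arith a b = mk⇔ there back
    where
    s = decodeTerm a
    t = decodeTerm b
    agrees : ∀ s t f g {v} → s ⇓ v → evalFor g t ≡ suc v → ifz (evalFor f s) 0 (differ (evalFor f s) (evalFor g t)) ≡ 0
    agrees s t f g {v} p q with evalFor f s in eq
    ... | zero  = refl
    ... | suc w rewrite q | ⇓-det (evalFor-sound f s eq) p = differ-refl (suc v)
    undefined-agrees : ∀ s t f g → ¬ Defined s → ifz (evalFor f s) 0 (differ (evalFor f s) (evalFor g t)) ≡ 0
    undefined-agrees s t f g p with evalFor f s in eq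
    ... | zero  = refl
    ... | suc w = ⊥-elim (p (w , evalFor-sound f s eq))
    there : s ≃ t → ∀ f → ∃ λ g → ≃-test f g a b ≡ 0
    there (inj₁ (p , q)) f = 0 , cong₂ _+_ (undefined-agrees s t f 0 p) (undefined-agrees t s f 0 q)
    there (inj₂ (v , p , q)) f with evalFor-complete p | evalFor-complete q
    ... | m , p′ | n , q′ = m ⊔ n , cong₂ _+_
      (agrees s t f (m ⊔ n) p (evalFor-mono n (m ⊔ n) t (m≤n⊔m m n) q′))
      (agrees t s f (m ⊔ n) q (evalFor-mono m (m ⊔ n) s (m≤m⊔n m n) p′))
    agrees-sound : ∀ s t f g {v} → evalFor f s ≡ suc v → ifz (evalFor f s) 0 (differ (evalFor f s) (evalFor g t)) ≡ 0 → t ⇓ v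
    agrees-sound s t f g eq h rewrite eq = evalFor-sound g t (sym (differ-0 (suc _) (evalFor g t) h))
    back : (∀ f → ∃ λ g → ≃-test f g a b ≡ 0) → s ≃ t
    back h with em {Defined s}
    ... | yes (v , p) with evalFor-complete p
    ...   | f , eq with h f
    ...     | g , z = inj₂ (v , p , agrees-sound s t f g eq (m+n≡0⇒m≡0 _ z))
    back h | no ¬p = inj₁ (¬p , undef)
      where
      undef : ¬ Defined t
      undef (v , q) with evalFor-complete q
      ... | f , eq with h f
      ... | g , z = ¬p (v , agrees-sound t s f g eq (m+n≡0⇒n≡0 (ifz (evalFor f s) 0 (differ (evalFor f s) (evalFor g t))) z))

  -- The level is part of the input because the next limit quantifies over it.
  SimUniform : ℕ → ℕ → Set
  SimUniform k d = SimSet k (snd d) (fst d)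

  simUniform-Π : ∀ k → Π⁰ (suc (suc (double k))) (SimUniform k)
  simSet-Σ : ∀ k → Σ⁰ (suc (double (suc k))) (SimSet (suc k) 0)

  simSet-Σ k = Σ-intro (simUniform-Π k) λ u → sim-limit k ⟫ mk⇔
    (λ (m , h) → m , from (conv u m) h) (λ (m , h) → m , to (conv u m) h)
    where
    conv : ∀ u m → SimUniform k (pair u m) ⇔ SimSet k m u
    conv u m = ≡⇔ (cong₂ (SimSet k) (snd-pair u m) (fst-pair u m))

  -- The stream of arguments and the step bound of the challenge form one number `z`, so both share
  -- the universal quantifier.
  simUniform-Π zero = Π-intro (Σ-intro (lift (computable-zeros testᵖ)) λ c → mk⇔ (λ h → h) (λ h → h))
    λ d → SimSet-applyMany 0 (snd d) (fst d) ⟫ mk⇔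
      (λ h z → to (conv d z) (to (≃-arith _ _) (h (fst z)) (snd z)))
      (λ h y → from (≃-arith _ _) λ f → from (conv′ d y f) (h (pair y f)))
    where
    target : ℕ → ℕ → ℕ
    target d y = applyMany (snd d) y (fst d)
    test : ℕ → ℕ → ℕ → ℕ → ℕ
    test d y f g = ≃-test f g (fst (target d y)) (snd (target d y))
    testᵖ : PR (λ x → test (fst (fst x)) (fst (snd (fst x))) (snd (snd (fst x))) (snd x))
    testᵖ = ≃-testᵖ (compᵖ sndᵖ (compᵖ sndᵖ fstᵖ)) sndᵖ (compᵖ fstᵖ tgt) (compᵖ sndᵖ tgt)
      where
      tgt : PR (λ x → target (fst (fst x)) (fst (snd (fst x))))
      tgt = applyManyᵖ (compᵖ sndᵖ (compᵖ fstᵖ fstᵖ)) (compᵖ fstᵖ (compᵖ sndᵖ fstᵖ)) (compᵖ fstᵖ (compᵖ fstᵖ fstᵖ))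
    Coded : ℕ → ℕ → Set
    Coded d z = ∃ λ g → test (fst (fst (pair (pair d z) g))) (fst (snd (fst (pair (pair d z) g))))
                             (snd (snd (fst (pair (pair d z) g)))) (snd (pair (pair d z) g)) ≡ 0
    conv : ∀ d z → (∃ λ g → test d (fst z) (snd z) g ≡ 0) ⇔ Coded d z
    conv d z = mk⇔ (λ (g , h) → g , trans (eq g) h) (λ (g , h) → g , trans (sym (eq g)) h)
      where
      eq : ∀ g → test (fst (fst (pair (pair d z) g))) (fst (snd (fst (pair (pair d z) g))))
                      (snd (snd (fst (pair (pair d z) g)))) (snd (pair (pair d z) g)) ≡ test d (fst z) (snd z) g
      eq g rewrite fst-pair (pair d z) g | snd-pair (pair d z) g | fst-pair d z | snd-pair d z = refl
    conv′ : ∀ d y f → (∃ λ g → test d y f g ≡ 0) ⇔ Coded d (pair y f)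
    conv′ d y f = ≡⇔ (cong₂ (λ a b → ∃ λ g → test d a b g ≡ 0) (sym (fst-pair y f)) (sym (snd-pair y f))) ⟫ conv d (pair y f)
  simUniform-Π (suc k) = Π-intro (Σ-sub _ argᵖ (simSet-Σ k)) λ d →
    SimSet-applyMany (suc k) (snd d) (fst d) ⟫ mk⇔
      (λ h y → subst (SimSet (suc k) 0) (sym (eq d y)) (h y)) (λ h y → subst (SimSet (suc k) 0) (eq d y) (h y))
    where
    argᵖ : PR (λ c → applyMany (snd (fst c)) (snd c) (fst (fst c)))
    argᵖ = applyManyᵖ (compᵖ sndᵖ fstᵖ) sndᵖ (compᵖ fstᵖ fstᵖ)
    eq : ∀ d y → applyMany (snd (fst (pair d y))) (snd (pair d y)) (fst (fst (pair d y))) ≡ applyMany (snd d) y (fst d)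
    eq d y rewrite fst-pair d y | snd-pair d y = refl

  simSet-Π : ∀ k n → Π⁰ (suc (suc (double k))) (SimSet k n)
  simSet-Π k n = Π-cong (λ u → ≡⇔ (sym (cong₂ (SimSet k) (snd-pair u n) (fst-pair u n))))
    (Π-sub _ (pairᵖ idᵖ (constᵖ n)) (simUniform-Π k))

-- Hardness

app-el : ∀ {e x v} → e · x ⇓ v → app (el e) (el x) ⇓ v
app-el h = app⇓ el⇓ el⇓ h

app-el⁻ : ∀ {e x v} → app (el e) (el x) ⇓ v → e · x ⇓ v
app-el⁻ (app⇓ el⇓ el⇓ h) = h

⇓-≅ : ∀ {t v} → t ⇓ v → t ≅ el v
⇓-≅ {t} h = (λ h′ → subst (el _ ⇓_) (⇓-det h h′) el⇓) , λ { el⇓ → h }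

curry-≅ : ∀ {g} (gᵖ : PR g) x y → app (el (curryIndex gᵖ x)) (el y) ≅ el (g (pair x y))
curry-≅ gᵖ x y = ⇓-≅ (app-el (curryIndex⇓ gᵖ x y))

universal-≅ : ∀ {a b} (aᵖ : PR a) (bᵖ : PR b) x y →
              app (el (universal aᵖ bᵖ x)) (el y) ≅ app (el (a (pair x y))) (el (b (pair x y)))
universal-≅ aᵖ bᵖ x y = app-el ∘ universal-sound aᵖ bᵖ x y ∘ app-el⁻ ,
                        app-el ∘ universal-complete aᵖ bᵖ x y ∘ app-el⁻

K : ℕ → ℕ
K = curryIndex fstᵖ

Kᵖ : PR K
Kᵖ = smnᵖ (curryᵖ fstᵖ)

K-≅ : ∀ a x → app (el (K a)) (el x) ≅ el a
K-≅ a x = subst (λ v → app (el (K a)) (el x) ≅ el v) (fst-pair a x) (curry-≅ fstᵖ a x)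

sim-K : ∀ k n a b → sim k (suc n) (el (K a)) (el (K b)) ⇔ sim k n (el a) (el b)
sim-K k n a b = sim-suc k n ⟫ mk⇔ (λ h → to (sim-≅ k n (K-≅ a 0) (K-≅ b 0)) (h 0))
                                  (λ h x → from (sim-≅ k n (K-≅ a x) (K-≅ b x)) h)

sim-pad : ∀ k m n a b → sim k (m + n) (el (iterate K m a)) (el (iterate K m b)) ⇔ sim k n (el a) (el b)
sim-pad k zero    n a b = mk⇔ (λ h → h) (λ h → h)
sim-pad k (suc m) n a b = ≡⇔ (cong (λ i → sim k i (el (iterate K m (K a))) (el (iterate K m (K b)))) (sym (+-suc m n)))
                          ⟫ sim-pad k m (suc n) (K a) (K b) ⟫ sim-K k n a b

nowhere : ℕ
nowhere = smn zeroᵖ 0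

nowhere-undefined : ∀ x → ¬ Defined (app (el nowhere) (el x))
nowhere-undefined x (v , h) with smn-sound zeroᵖ 0 x (app-el⁻ h)
... | z , ()

-- tower m can be applied exactly m times.
tower : ℕ → ℕ
tower m = iterate K m nowhere

towerᵖ : PR tower
towerᵖ = comp₂ᵖ {iterate K} (iterᵖ Kᵖ) idᵖ (constᵖ nowhere)

tower-≅ : ∀ m x → app (el (tower (suc m))) (el x) ≅ el (tower m)
tower-≅ m x = subst (λ a → app (el a) (el x) ≅ el (tower m)) (sym (iterate-suc K m nowhere)) (K-≅ (tower m) x)

undefined-app : ∀ {s t} → ¬ Defined s → ¬ Defined (app s t)
undefined-app u (_ , app⇓ h _ _) = u (_ , h)

-- After `m` applications the tower is down to the element `nowhere`, still defined; one more makes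
-- it undefined like `u`. Together with `¬sim-tower`, the least level is exactly `m + 1`.
sim-tower : ∀ m {u} → ¬ Defined u → sim 0 (suc m) u (el (tower m))
sim-tower zero    u x = inj₁ (undefined-app u , nowhere-undefined x)
sim-tower (suc m) u x = from (sim-≅ 0 (suc m) ≅-refl (tower-≅ m x)) (sim-tower m (undefined-app u))

¬sim-tower : ∀ m {u} → ¬ Defined u → ¬ sim 0 m u (el (tower m))
¬sim-tower zero    u (inj₁ (_ , h))     = h (_ , el⇓)
¬sim-tower zero    u (inj₂ (v , h , _)) = u (v , h)
¬sim-tower (suc m) u h = ¬sim-tower m (undefined-app u) (to (sim-≅ 0 m ≅-refl (tower-≅ m 0)) (h 0))

-- Lets a single number refute finitely many candidates at once, each by its own entry.
collect : (P : ℕ → ℕ → Set) → (∀ w → ∃ (P w)) → ∀ n → ∃ λ c → ∀ w → w < n → P w (lookupˢ w c)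
collect P h zero    = 0 , λ w ()
collect P h (suc n) with h 0 | collect (P ∘ suc) (h ∘ suc) n
... | y , p | c , q = pair y c , λ
  { zero    _        → subst (P 0) (sym (fst-pair y c)) p
  ; (suc w) (s≤s lt) → subst (λ k → P (suc w) (lookupˢ w k)) (sym (snd-pair y c)) (q w lt) }

-- Gadgets, by induction on `k`

module Hardness (em : ExcludedMiddle 0ℓ) where
  open Classical em

  -- At level 0 application respects `≃`, after deciding whether the result is defined. At a limit,
  -- a witness level `m` is also good as `m + 1`, which leaves `m` for the applied terms.
  sim-step : ∀ k n {s t} → sim k n s t → sim k (suc n) s t
  below-step : ∀ k {s t} x → below k s t → below k (app s (el x)) (app t (el x))
  sim-step zero zero (inj₁ (p , q)) x = inj₁ (undefined-app p , undefined-app q)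
  sim-step zero zero {s} {t} (inj₂ (a , p , q)) x with em {Defined (app s (el x))}
  ... | yes (v , app⇓ p′ el⇓ r) rewrite ⇓-det p′ p = inj₂ (v , app⇓ p el⇓ r , app⇓ q el⇓ r)
  ... | no u = inj₁ (u , λ { (v , app⇓ q′ el⇓ r) → u (v , app⇓ p el⇓ (subst (λ b → b · x ⇓ v) (⇓-det q′ q) r)) })
  sim-step (suc k) zero h x = below-step (suc k) x h
  sim-step k (suc n) h = from (sim-suc k (suc n)) λ x → sim-step k n (to (sim-suc k n) h x)
  below-step (suc k) x (inj₁ h)       = inj₁ (below-step k x h)
  below-step (suc k) x (inj₂ (m , h)) = inj₂ (m , to (sim-suc k m) (sim-step k m h) x)

  sim-mono : ∀ k m n {s t} → m ≤ n → sim k m s t → sim k n s t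
  sim-mono k m n m≤n = go (≤⇒≤′ m≤n)
    where
    go : ∀ {m n s t} → m ≤′ n → sim k m s t → sim k n s t
    go ≤′-refl      h = h
    go (≤′-step lt) h = sim-step k _ (go lt h)

  eventual-form : ∀ n {A} → Σ⁰ (suc (suc (suc n))) A → Σ (ℕ → Set) λ Q → Σ⁰ (suc n) Q ×
    (∀ x → (A x → ∃ λ m₀ → ∀ m y → m₀ ≤ m → Q (pair x (pair m y))) × (¬ A x → ∀ m → ∃ λ y → ¬ Q (pair x (pair m y))))
  eventual-form n {A} a with Σ-elim a
  ... | D , d , A⇔ with Π-elim d
  ... | B , b , D⇔ with Σ-elim b
  ... | C , c , B⇔ = Q , Σ-intro (Π-sub n argᵖ c) Q⇔ , λ x → eventually x , never x
    where
    entry : ℕ → ℕ → ℕ → ℕ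
    entry x w y = pair (pair x w) (lookupˢ w y)
    Q : ℕ → Set
    Q v = ∃ λ w → w ≤ fst (snd v) × B (entry (fst v) w (snd (snd v)))
    clamp : ℕ → ℕ → ℕ
    -- The minimum of `m` and `w`. It replaces the bound on `w` by an unbounded quantifier, which
    -- merges with the existential one of the class.
    clamp m w = m ∸ (m ∸ w)
    arg : ℕ → ℕ → ℕ
    arg v p = pair (entry (fst v) (clamp (fst (snd v)) (fst p)) (snd (snd v))) (snd p)
    argᵖ : PR₂ arg
    argᵖ = pairᵖ (pairᵖ (pairᵖ (compᵖ fstᵖ fstᵖ) w) (lookupᵖ w (compᵖ sndᵖ (compᵖ sndᵖ fstᵖ)))) (compᵖ sndᵖ sndᵖ)
      where
      m : PR (λ x → fst (snd (fst x)))
      m = compᵖ fstᵖ (compᵖ sndᵖ fstᵖ)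
      w : PR (λ x → clamp (fst (snd (fst x))) (fst (snd x)))
      w = m ∸ᵖ (m ∸ᵖ compᵖ fstᵖ sndᵖ)
    arg-pair : ∀ v p → arg (fst (pair v p)) (snd (pair v p)) ≡ arg v p
    arg-pair v p = cong₂ arg (fst-pair v p) (snd-pair v p)
    Q⇔ : ∀ v → Q v ⇔ (∃ λ p → C (arg (fst (pair v p)) (snd (pair v p))))
    Q⇔ v = mk⇔ there back
      where
      there : Q v → ∃ λ p → C (arg (fst (pair v p)) (snd (pair v p)))
      there (w , w≤m , h) with to (B⇔ _) h
      ... | z , h′ = pair w z , subst C (sym (trans (arg-pair v (pair w z)) eq)) h′
        where
        eq : arg v (pair w z) ≡ pair (entry (fst v) w (snd (snd v))) z
        eq = cong₂ (λ i j → pair (entry (fst v) i (snd (snd v))) j)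
               (trans (cong (clamp (fst (snd v))) (fst-pair w z)) (m∸[m∸n]≡n w≤m)) (snd-pair w z)
      back : (∃ λ p → C (arg (fst (pair v p)) (snd (pair v p)))) → Q v
      back (p , h) = clamp (fst (snd v)) (fst p) , m∸n≤m (fst (snd v)) (fst (snd v) ∸ fst p) ,
                     from (B⇔ _) (snd p , subst C (arg-pair v p) h)
    Q-pair : ∀ x m y → Q (pair x (pair m y)) ⇔ (∃ λ w → w ≤ m × B (entry x w y))
    Q-pair x m y = ≡⇔ (trans (cong₂ R (fst-pair x _) (snd-pair x _))
      (cong₂ (λ i j → ∃ λ w → w ≤ i × B (entry x w j)) (fst-pair m y) (snd-pair m y)))
      where
      R : ℕ → ℕ → Set
      R i j = ∃ λ w → w ≤ fst j × B (entry i w (snd j))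
    eventually : ∀ x → A x → ∃ λ m₀ → ∀ m y → m₀ ≤ m → Q (pair x (pair m y))
    eventually x h with to (A⇔ x) h
    ... | w , h′ = w , λ m y w≤m → from (Q-pair x m y) (w , w≤m , to (D⇔ (pair x w)) h′ (lookupˢ w y))
    never : ∀ x → ¬ A x → ∀ m → ∃ λ y → ¬ Q (pair x (pair m y))
    never x ¬a m with collect (λ w y → ¬ B (pair (pair x w) y))
      (λ w → ¬∀⇒∃¬ λ h → ¬a (from (A⇔ x) (w , from (D⇔ (pair x w)) h))) (suc m)
    ... | y , h = y , λ q → let w , w≤m , b = to (Q-pair x m y) q in h w (s≤s w≤m) b

  record Gadget (k : ℕ) (Q : ℕ → Set) : Set where
    field
      {s t}  : ℕ → ℕ
      sᵖ     : PR s
      tᵖ     : PR t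
      holds  : ∀ x m → Q x → sim k 1 (el (s (pair x m))) (el (t (pair x m)))
      fails  : ∀ x m → ¬ Q x → ¬ sim k (suc m) (el (s (pair x m))) (el (t (pair x m)))
      always : ∀ x m → sim k (suc (suc m)) (el (s (pair x m))) (el (t (pair x m)))

  record LimitGadget (k : ℕ) (A : ℕ → Set) : Set where
    field
      {s t}  : ℕ → ℕ
      sᵖ     : PR s
      tᵖ     : PR t
      holds  : ∀ x → A x → sim k 0 (el (s x)) (el (t x))
      fails  : ∀ x → ¬ A x → ¬ sim k 0 (el (s x)) (el (t x))
      always : ∀ x → sim k 1 (el (s x)) (el (t x))

  -- t is the constant function tower m; s is the same function, but first waits for Q x.
  gadget-0 : ∀ {Q} → Σ⁰ 1 Q → Gadget 0 Q
  gadget-0 {Q} σ with Σ-elim σ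
  ... | C , lift (e , test) , Q⇔ = record
    { sᵖ = smnᵖ qᵖ ; tᵖ = compᵖ Kᵖ (compᵖ towerᵖ sndᵖ) ; holds = holds ; fails = fails ; always = always }
    where
    q : ℕ → ℕ → ℕ → ℕ → ℕ
    -- A candidate is a step bound `f` with a witness `y`. The accepting output 1 shows up as 2,
    -- since `runFor` keeps 0 for no output.
    q x m f y = ifz (differ (runFor f e (pair x y)) 2) (suc (tower m)) 0
    qᵖ : PR (λ w → q (fst (fst (fst w))) (snd (fst (fst w))) (fst (snd w)) (snd (snd w)))
    qᵖ = ifzᵖ (differᵖ (runForᵖ (compᵖ fstᵖ sndᵖ) (constᵖ e) (pairᵖ (compᵖ fstᵖ (compᵖ fstᵖ fstᵖ)) (compᵖ sndᵖ sndᵖ))) (constᵖ 2))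
              (compᵖ sucᵖ (compᵖ towerᵖ (compᵖ sndᵖ (compᵖ fstᵖ fstᵖ)))) zeroᵖ
    s t : ℕ → ℕ
    s = smn qᵖ
    t = K ∘ tower ∘ snd
    q-args : ∀ x m y z → q (fst (fst (fst (pair (pair (pair x m) y) z)))) (snd (fst (fst (pair (pair (pair x m) y) z))))
                           (fst (snd (pair (pair (pair x m) y) z))) (snd (snd (pair (pair (pair x m) y) z)))
                         ≡ q x m (fst z) (snd z)
    q-args x m y z rewrite fst-pair (pair (pair x m) y) z | snd-pair (pair (pair x m) y) z
                         | fst-pair (pair x m) y | fst-pair x m | snd-pair x m = refl
    q-sound : ∀ x m f y {v} → q x m f y ≡ suc v → v ≡ tower m × e · pair x y ⇓ 1
    q-sound x m f y eq with differ (runFor f e (pair x y)) 2 in eq′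
    ... | zero = sym (suc-injective eq) , runFor-sound f e _ (differ-0 _ 2 eq′)
    C-accepts : ∀ c → C c → e · c ⇓ 1
    C-accepts c h with test c
    ... | inj₁ (_ , r) = r
    ... | inj₂ (n , _) = ⊥-elim (n h)
    accepts-C : ∀ c → e · c ⇓ 1 → C c
    accepts-C c r with test c
    ... | inj₁ (h , _)  = h
    ... | inj₂ (_ , r′) with ·⇓-det r r′
    ...   | ()
    s-sound : ∀ x m y {v} → s (pair x m) · y ⇓ v → v ≡ tower m × Q x
    s-sound x m y h with smn-sound qᵖ (pair x m) y h
    ... | z , eq with q-sound x m (fst z) (snd z) (trans (sym (q-args x m y z)) eq)
    ... | v≡ , r = v≡ , from (Q⇔ x) (snd z , accepts-C _ r)
    s-halts : ∀ x m y → Q x → s (pair x m) · y ⇓ tower m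
    s-halts x m y h with to (Q⇔ x) h
    ... | w , c with runFor-complete (C-accepts _ c)
    ... | f , eq with smn-halts qᵖ (pair x m) y (pair f w) {tower m}
            (trans (q-args x m y (pair f w)) (trans (cong₂ (q x m) (fst-pair f w) (snd-pair f w))
              (cong (λ u → ifz (differ u 2) (suc (tower m)) 0) eq)))
    ... | v , r = subst (s (pair x m) · y ⇓_) (proj₁ (s-sound x m y r)) r
    s-undefined : ∀ x m y → ¬ Q x → ¬ Defined (app (el (s (pair x m))) (el y))
    s-undefined x m y ¬h (v , r) = ¬h (proj₂ (s-sound x m y (app-el⁻ r)))
    t-≅ : ∀ x m y → app (el (t (pair x m))) (el y) ≅ el (tower m)
    t-≅ x m y = subst (λ k → app (el (K (tower k))) (el y) ≅ el (tower m)) (sym (snd-pair x m)) (K-≅ (tower m) y)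
    holds : ∀ x m → Q x → sim 0 1 (el (s (pair x m))) (el (t (pair x m)))
    holds x m h y = inj₂ (tower m , app-el (s-halts x m y h) , proj₂ (t-≅ x m y) el⇓)
    fails : ∀ x m → ¬ Q x → ¬ sim 0 (suc m) (el (s (pair x m))) (el (t (pair x m)))
    fails x m ¬h h = ¬sim-tower m (s-undefined x m 0 ¬h) (to (sim-≅ 0 m ≅-refl (t-≅ x m 0)) (h 0))
    always : ∀ x m → sim 0 (suc (suc m)) (el (s (pair x m))) (el (t (pair x m)))
    always x m with em {Q x}
    ... | yes h = sim-mono 0 1 (suc (suc m)) (s≤s z≤n) (holds x m h)
    ... | no ¬h = λ y → from (sim-≅ 0 (suc m) ≅-refl (t-≅ x m y)) (sim-tower m (s-undefined x m y ¬h))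

  gadget-limit : ∀ k {A} → (∀ {Q} → Σ⁰ (suc (double k)) Q → Gadget k Q) →
                 Σ⁰ (suc (double (suc k))) A → LimitGadget (suc k) A
  gadget-limit k {A} gadget σ with eventual-form (double k) σ
  ... | Q , q , A-Q = record
    { sᵖ = smnᵖ (curryᵖ (compᵖ G.sᵖ argᵖ)) ; tᵖ = smnᵖ (curryᵖ (compᵖ G.tᵖ argᵖ))
    ; holds = holds ; fails = fails ; always = always }
    where
    module G = Gadget (gadget q)
    arg : ℕ → ℕ
    -- With `w = (x , (m , y))`, the gadget for `Q w` gets this same `m`, so its failure level grows
    -- along the family.
    arg w = pair w (fst (snd w))
    argᵖ : PR arg
    argᵖ = pairᵖ idᵖ (compᵖ fstᵖ sndᵖ)
    U V : ℕ → ℕ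
    U = curryIndex (compᵖ G.sᵖ argᵖ)
    V = curryIndex (compᵖ G.tᵖ argᵖ)
    sim-apply : ∀ n x u → sim k n (app (el (U x)) (el u)) (app (el (V x)) (el u)) ⇔
                          sim k n (el (G.s (arg (pair x u)))) (el (G.t (arg (pair x u))))
    sim-apply n x u = sim-≅ k n (curry-≅ (compᵖ G.sᵖ argᵖ) x u) (curry-≅ (compᵖ G.tᵖ argᵖ) x u)
    alwaysₖ : ∀ x u → sim k (suc (suc (fst u))) (el (G.s (arg (pair x u)))) (el (G.t (arg (pair x u))))
    alwaysₖ x u = subst (λ i → sim k (suc (suc i)) (el (G.s (arg (pair x u)))) (el (G.t (arg (pair x u)))))
      (cong fst (snd-pair x u)) (G.always (pair x u) (fst (snd (pair x u))))
    holds : ∀ x → A x → sim (suc k) 0 (el (U x)) (el (V x))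
    holds x a with proj₁ (A-Q x) a
    -- The application uses one level, and `m₀ + 1` remain: level 1 suffices for `m ≥ m₀`, and
    -- `m + 2` is at most `m₀ + 1` for the finitely many smaller `m`.
    ... | m₀ , h = inj₂ (suc (suc m₀) , from (sim-suc k (suc m₀)) λ u → from (sim-apply (suc m₀) x u) (go u))
      where
      go : ∀ u → sim k (suc m₀) (el (G.s (arg (pair x u)))) (el (G.t (arg (pair x u))))
      go u with ≤-<-connex m₀ (fst u)
      ... | inj₁ le = sim-mono k 1 (suc m₀) (s≤s z≤n) (G.holds (pair x u) _
                        (subst (λ w → Q (pair x w)) (pair-unpair u) (h (fst u) (snd u) le)))
      ... | inj₂ lt = sim-mono k (suc (suc (fst u))) (suc m₀) (s≤s lt) (alwaysₖ x u)
    fails : ∀ x → ¬ A x → ¬ sim (suc k) 0 (el (U x)) (el (V x))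
    fails x ¬a h with to (sim-limit k) h
    ... | j , hj with proj₂ (A-Q x) ¬a j
    -- A common level `j` is refuted at `m = j`: raised by one before the application and by one
    -- after it, it would relate the values at `j + 1`, where this gadget fails.
    ...   | y , ¬q = G.fails (pair x u) (fst (snd (pair x u))) ¬q
        (subst (λ i → sim k (suc i) (el (G.s (arg (pair x u)))) (el (G.t (arg (pair x u)))))
          (sym (trans (cong fst (snd-pair x u)) (fst-pair j y)))
          (sim-step k j (to (sim-apply j x u) (to (sim-suc k j) (sim-step k j hj) u))))
      where
      u = pair j y
    always : ∀ x → sim (suc k) 1 (el (U x)) (el (V x))
    always x u = inj₂ (suc (suc (fst u)) , from (sim-apply _ x u) (alwaysₖ x u))

  -- Padding moves the levels 0 and 1 of `fails` and `always` to `m + 1` and `m + 2`, but leaves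
  -- `holds` alone: a relation strictly below the limit remains below it after finitely many dummy
  -- arguments.
  limit⇒gadget : ∀ k {A} → LimitGadget (suc k) A → Gadget (suc k) A
  limit⇒gadget k {A} g = record
    { sᵖ = padᵖ L.sᵖ ; tᵖ = padᵖ L.tᵖ
    ; holds = λ x m a → holds x m (sim-limit k .to (L.holds x a))
    ; fails = λ x m ¬a h → L.fails x ¬a (to (sim-pad (suc k) (suc m) 0 _ _)
                (subst (λ i → sim (suc k) i (pad L.s x m) (pad L.t x m)) (sym (+-identityʳ (suc m))) (to (pads x m (suc m)) h)))
    ; always = λ x m → from (pads x m (suc (suc m))) (subst (λ i → sim (suc k) i (pad L.s x m) (pad L.t x m)) (+-comm (suc m) 1)
                (from (sim-pad (suc k) (suc m) 1 _ _) (L.always x)))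
    }
    where
    module L = LimitGadget g
    pad : (ℕ → ℕ) → ℕ → ℕ → Term
    pad s x m = el (iterate K (suc m) (s x))
    padᵖ : ∀ {s} → PR s → PR (λ w → iterate K (suc (snd w)) (s (fst w)))
    padᵖ sᵖ = comp₂ᵖ {iterate K} (iterᵖ Kᵖ) (compᵖ sucᵖ sndᵖ) (compᵖ sᵖ fstᵖ)
    pads : ∀ x m n → sim (suc k) n (el (iterate K (suc (snd (pair x m))) (L.s (fst (pair x m)))))
                                     (el (iterate K (suc (snd (pair x m))) (L.t (fst (pair x m))))) ⇔
                       sim (suc k) n (pad L.s x m) (pad L.t x m)
    pads x m n = ≡⇔ (cong₂ (λ a b → sim (suc k) n (pad L.s a b) (pad L.t a b)) (fst-pair x m) (snd-pair x m))
    holds : ∀ x m → (∃ λ j → sim k j (el (L.s x)) (el (L.t x))) →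
            sim (suc k) 1 (el (iterate K (suc (snd (pair x m))) (L.s (fst (pair x m)))))
                          (el (iterate K (suc (snd (pair x m))) (L.t (fst (pair x m)))))
    holds x m (j , h) = from (pads x m 1) (sim-step (suc k) 0
      (from (sim-limit k) (suc m + j , from (sim-pad k (suc m) j _ _) h)))

  gadget : ∀ k {Q} → Σ⁰ (suc (double k)) Q → Gadget k Q
  gadget zero    = gadget-0
  gadget (suc k) = λ q → limit⇒gadget k (gadget-limit k (gadget k) q)

  -- From gadgets to many-one reductions

  reduce : ∀ k n {A s t} → PR s → PR t → (∀ x → A x ⇔ sim k n (el (s x)) (el (t x))) → A ≤m SimSet k n
  reduce k n {s = s} {t} sᵖ tᵖ A⇔ = index fᵖ , f , index⇓ fᵖ , λ x → A⇔ x ⟫ ≡⇔ (sym (cong₂ (sim k n)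
    (trans (cong decodeTerm (fst-pair _ _)) (decode-elCode (s x)))
    (trans (cong decodeTerm (snd-pair _ _)) (decode-elCode (t x)))))
    where
    f : ℕ → ℕ
    f x = pair (elCode (s x)) (elCode (t x))
    fᵖ : PR f
    fᵖ = pairᵖ (sᵖ +ᵖ sᵖ) (tᵖ +ᵖ tᵖ)

  simSet-Σ-hard : ∀ k {A} → Σ⁰ (suc (double (suc k))) A → A ≤m SimSet (suc k) 0
  simSet-Σ-hard k {A} a = reduce (suc k) 0 L.sᵖ L.tᵖ λ x → mk⇔ (L.holds x) λ h → dne λ ¬a → L.fails x ¬a h
    where
    module L = LimitGadget (gadget-limit k (gadget k) a)

  -- A x is sim k 1 for all pairs given by a gadget on ⟨ x , y ⟩; the quantifier over y is merged
  -- with the one in sim k 1 by a function that takes both arguments at once.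
  simSet-Π-hard : ∀ k n {A} → Π⁰ (suc (suc (double k))) A → A ≤m SimSet k (suc n)
  simSet-Π-hard k n {A} a with Π-elim a
  ... | B , b , A⇔ = reduce k (suc n) (padᵖ Uᵖ) (padᵖ Vᵖ) λ x → A⇔ x ⟫ all⇔ x ⟫ pads x
    where
    module G = Gadget (gadget k b)
    arg : ℕ → ℕ
    -- Here `w = (x , (y , z))`, and the gadget is taken at `m = 0`, where its failure concerns
    -- level 1 itself.
    arg w = pair (pair (fst w) (fst (snd w))) 0
    argᵖ : PR arg
    argᵖ = pairᵖ (pairᵖ fstᵖ (compᵖ fstᵖ sndᵖ)) zeroᵖ
    U V : ℕ → ℕ
    -- The value at `(y , z)` is the application of a gadget element to `z`, which may be undefined,
    -- so it has to be simulated.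
    U = universal (compᵖ G.sᵖ argᵖ) (compᵖ sndᵖ sndᵖ)
    V = universal (compᵖ G.tᵖ argᵖ) (compᵖ sndᵖ sndᵖ)
    Uᵖ : PR U
    Uᵖ = smnᵖ _
    Vᵖ : PR V
    Vᵖ = smnᵖ _
    padᵖ : ∀ {s} → PR s → PR (λ x → iterate K n (s x))
    padᵖ sᵖ = comp₂ᵖ {iterate K} (iterᵖ Kᵖ) (constᵖ n) sᵖ
    Inner : ℕ → ℕ → ℕ → Set
    Inner x y z = sim k 0 (app (el (G.s (pair (pair x y) 0))) (el z)) (app (el (G.t (pair (pair x y) 0))) (el z))
    outer : ∀ x u → sim k 0 (app (el (U x)) (el u)) (app (el (V x)) (el u)) ⇔ Inner x (fst u) (snd u)
    outer x u = sim-≅ k 0 (universal-≅ _ _ x u) (universal-≅ _ _ x u) ⟫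
      ≡⇔ (cong₂ (λ i j → Inner i (fst j) (snd j)) (fst-pair x u) (snd-pair x u))
    B⇔ : ∀ x y → B (pair x y) ⇔ (∀ z → Inner x y z)
    B⇔ x y = mk⇔ (G.holds (pair x y) 0) (λ h → dne λ ¬b → G.fails (pair x y) 0 ¬b h) ⟫ sim-suc k 0
    all⇔ : ∀ x → (∀ y → B (pair x y)) ⇔ sim k 1 (el (U x)) (el (V x))
    all⇔ x = mk⇔ (λ h → from (sim-suc k 0) λ u → from (outer x u) (to (B⇔ x (fst u)) (h (fst u)) (snd u)))
      λ h y → from (B⇔ x y) λ z → subst₂ (Inner x) (fst-pair y z) (snd-pair y z)
        (to (outer x (pair y z)) (to (sim-suc k 0) h (pair y z)))
    pads : ∀ x → sim k 1 (el (U x)) (el (V x)) ⇔ sim k (suc n) (el (iterate K n (U x))) (el (iterate K n (V x)))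
    pads x = mk⇔ (λ h → subst P (+-comm n 1) (from (sim-pad k n 1 _ _) h))
                 (λ h → to (sim-pad k n 1 _ _) (subst P (+-comm 1 n) h))
      where
      P : ℕ → Set
      P i = sim k i (el (iterate K n (U x))) (el (iterate K n (V x)))

theorem6p7 : ExcludedMiddle 0ℓ →
    ((k : ℕ) → 1 ≤ k → Complete (Σ⁰ (2 * k + 1)) (SimSet k 0))
    × ((k n : ℕ) → 1 ≤ n → Complete (Π⁰ (2 * k + 2)) (SimSet k n))
theorem6p7 em = part₁ , part₂
  where
  open Classical em
  open Hardness em
  part₁ : (k : ℕ) → 1 ≤ k → Complete (Σ⁰ (2 * k + 1)) (SimSet k 0)
  part₁ (suc k) _ = subst (λ i → Complete (Σ⁰ i) (SimSet (suc k) 0))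
    (sym (trans (+-comm _ 1) (cong suc (2*≡double (suc k))))) (simSet-Σ k , λ _ → simSet-Σ-hard k)
  part₂ : (k n : ℕ) → 1 ≤ n → Complete (Π⁰ (2 * k + 2)) (SimSet k n)
  part₂ k (suc n) _ = subst (λ i → Complete (Π⁰ i) (SimSet k (suc n)))
    (sym (trans (+-comm _ 2) (cong (suc ∘ suc) (2*≡double k)))) (simSet-Π k (suc n) , λ _ → simSet-Π-hard k n)
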